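{- Let $n\ge 1$ and let $K$ be the Kasteleyn matrix of the uniformly weighted Aztec diamond of size $n$, i.e. for $x\in\mathtt{B}$, $y\in\mathtt{W}$, $$K(x,y)=\begin{cases}1 & x-y=\pm e_1,\\ \mathrm{i} & x-y=\pm e_2,\\ 0&\text{otherwise.}\end{cases}$$ Let $G_n(\mathtt{w},\mathtt{b})=\sum_{x\in\mathtt{W},\,y\in\mathtt{B}} K^{ -1}(x,y)\,w_1^{x_1}w_2^{x_2}b_1^{y_1}b_2^{y_2}$. Then $$\begin{aligned}G_n(\mathtt{w},\mathtt{b})=&\ \frac{w_1w_2^2b_2\,f_{n+1}(w_1^2b_1^2)\,f_n(w_2^2b_2^2)}{C(w_1,w_2)}\\ &+(1+\mathrm{i}w_1^2)\frac{(1+\mathrm{i}b_2^2)F^{0,0}_n+b_1^2\big(b_2w_1f_n(b_1^2w_1^2)+(\mathrm{i}+b_2^2)F^{0,1}_n\big)}{C(w_1,w_2)C(b_1,b_2)}\\ &+(\mathrm{i}+w_1^2)w_2^2\frac{b_1^2b_2^{2n+1}w_1w_2^{2n}f_n(b_1^2w_1^2)+(1+\mathrm{i}b_2^2)F^{1,0}_n+b_1^2(\mathrm{i}+b_2^2)F^{1,1}_n}{C(w_1,w_2)C(b_1,b_2)},\end{aligned}$$ where $C(r_1,r_2)=1+r_1^2r_2^2+\mathrm{i}(r_1^2+r_2^2)$ and $F^{k,l}_n=F^{k,l}_n(\mathtt{w},\mathtt{b})$ are as defined in the context.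
   Context: $\mathrm{i}=\sqrt{ -1}$. Aztec diamond of size $n$ (Kasteleyn coordinates): white vertices $\mathtt{W}=\{(x_1,x_2): x_1\text{ odd},\ x_2\text{ even},\ 1\le x_1\le 2n-1,\ 0\le x_2\le 2n\}$, black vertices $\mathtt{B}=\{(x_1,x_2): x_1\text{ even},\ x_2\text{ odd},\ 0\le x_1\le 2n,\ 1\le x_2\le 2n-1\}$, $e_1=(1,1)$, $e_2=(-1,1)$; a black vertex $x$ and a white vertex $y$ are adjacent iff $x-y\in\{\pm e_1,\pm e_2\}$. $K$ has rows indexed by $\mathtt{B}$ and columns by $\mathtt{W}$, so $K^{ -1}$ is indexed by $\mathtt{W}\times\mathtt{B}$. $\mathtt{w}=(w_1,w_2)$, $\mathtt{b}=(b_1,b_2)$ are formal variables. $f_n(t)=(1-t^n)/(1-t)=1+t+\dots+t^{n-1}$. Define $F_n(w,b)=-\frac{\mathrm{i}}{2}f_n\!\left(\frac{(1+b\mathrm{i})(1+w\mathrm{i})}{2}\right)$ and $F^{0,0}_n(\mathtt{w},\mathtt{b})=F_n(w_1^2,b_2^2)w_1b_2$, $F^{0,1}_n(\mathtt{w},\mathtt{b})=F_n(-1/w_1^2,-b_2^2)w_1^{2n-1}b_1^{2n}b_2\mathrm{i}$, $F^{1,0}_n(\mathtt{w},\mathtt{b})=F_n(-w_1^2,-1/b_2^2)w_1w_2^{2n}b_2^{2n-1}\mathrm{i}$, $F^{1,1}_n(\mathtt{w},\mathtt{b})=F_n(1/w_1^2,1/b_2^2)w_1^{2n-1}w_2^{2n}b_1^{2n}b_2^{2n-1}$.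 -}

module Defs where

open import Algebra.Bundles using (CommutativeRing)
open import Data.Bool.Base using (if_then_else_; _∨_)
open import Data.Fin.Base using (Fin; toℕ)
import Data.Fin.Properties as Fin
open import Data.Integer.Base as ℤ using (ℤ; +_; -1ℤ; 1ℤ)
import Data.Integer.Properties as ℤ
open import Data.Nat.Base as ℕ using (ℕ; suc)
open import Data.Product.Base using (_×_; _,_; proj₁; proj₂)
open import Data.Product.Properties using (≡-dec)
open import Level using (Level; _⊔_) renaming (suc to lsuc)
open import Relation.Binary.Definitions using (DecidableEquality)
open import Relation.Nullary.Decidable.Core using (does)

-- The role of ℂ: any commutative ring with a square root 𝕚 of -1 in which
-- 2 is invertible.
record CoefficientRing (c ℓ : Level) : Set (lsuc (c ⊔ ℓ)) where
  field
    commutativeRing : CommutativeRing c ℓ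
  open CommutativeRing commutativeRing public
  field
    𝕚    : Carrier
    ½    : Carrier
    𝕚*𝕚  : 𝕚 * 𝕚 ≈ - 1#
    ½+½  : ½ + ½ ≈ 1#

-- (i , j) stands for the vertex (2i+1 , 2j).
White : ℕ → Set
White n = Fin n × Fin (suc n)

-- (i , j) stands for the vertex (2i , 2j+1).
Black : ℕ → Set
Black n = Fin (suc n) × Fin n

whitePos : ∀ {n} → White n → ℕ × ℕ
whitePos (i , j) = 2 ℕ.* toℕ i ℕ.+ 1 , 2 ℕ.* toℕ j

blackPos : ∀ {n} → Black n → ℕ × ℕ
blackPos (i , j) = 2 ℕ.* toℕ i , 2 ℕ.* toℕ j ℕ.+ 1

_≟ʷ_ : ∀ {n} → DecidableEquality (White n)
_≟ʷ_ = ≡-dec Fin._≟_ Fin._≟_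

_≟ᵇ_ : ∀ {n} → DecidableEquality (Black n)
_≟ᵇ_ = ≡-dec Fin._≟_ Fin._≟_

ℤ² : Set
ℤ² = ℤ × ℤ

_≟²_ : DecidableEquality ℤ²
_≟²_ = ≡-dec ℤ._≟_ ℤ._≟_

neg : ℤ² → ℤ²
neg (x , y) = ℤ.- x , ℤ.- y

_∸²_ : ℕ × ℕ → ℕ × ℕ → ℤ²
(x₁ , x₂) ∸² (y₁ , y₂) = (+ x₁) ℤ.- (+ y₁) , (+ x₂) ℤ.- (+ y₂)

e₁ e₂ : ℤ²
e₁ = 1ℤ , 1ℤ
e₂ = -1ℤ , 1ℤ

module Kasteleyn {c ℓ} (R : CoefficientRing c ℓ) (n : ℕ) where
  open CoefficientRing R
  open import Algebra.Properties.Semiring.Sum semiring using (sum-syntax)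

  K : Black n → White n → Carrier
  K x y =
    if does (d ≟² e₁) ∨ does (d ≟² neg e₁) then 1#
    else if does (d ≟² e₂) ∨ does (d ≟² neg e₂) then 𝕚
    else 0#
    where d = blackPos x ∸² whitePos y

  record IsInverse (M : Black n → White n → Carrier)
                   (L : White n → Black n → Carrier) : Set ℓ where
    field
      inverseʳ : ∀ x x′ →
        ∑[ i < n ] ∑[ j < suc n ] (M x (i , j) * L (i , j) x′)
          ≈ (if does (x ≟ᵇ x′) then 1# else 0#)
      inverseˡ : ∀ y y′ →
        ∑[ i < suc n ] ∑[ j < n ] (L y (i , j) * M (i , j) y′)
          ≈ (if does (y ≟ʷ y′) then 1# else 0#)

-- Formal variables are treated through their universal property: they are
-- arbitrary elements w₁, w₂, b₁, b₂ of an arbitrary commutative algebra A over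
-- the coefficient ring R (with structure map φ), subject only to the
-- invertibility of the denominators that occur. One instance of A is the
-- field ℂ(w₁,w₂,b₁,b₂) over R = ℂ.
module Series {c ℓ c′ ℓ′} (R : CoefficientRing c ℓ) (A : CommutativeRing c′ ℓ′)
              (φ : CoefficientRing.Carrier R → CommutativeRing.Carrier A)
              where
  private module R = CoefficientRing R
  open CommutativeRing A
  open import Algebra.Properties.Semiring.Sum semiring using (sum-syntax)
  open import Algebra.Properties.Semiring.Exp semiring using (_^_)

  i : Carrier
  i = φ R.𝕚

  C : Carrier → Carrier → Carrier
  C r₁ r₂ = 1# + r₁ ^ 2 * r₂ ^ 2 + i * (r₁ ^ 2 + r₂ ^ 2)

  f : ℕ → Carrier → Carrier
  f n t = ∑[ k < n ] (t ^ toℕ k)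

  F : ℕ → Carrier → Carrier → Carrier
  F n w b = - (i * φ R.½) * f n ((1# + b * i) * (1# + w * i) * φ R.½)

  G : (n : ℕ) → (White n → Black n → R.Carrier) →
      (w₁ w₂ b₁ b₂ : Carrier) → Carrier
  G n L w₁ w₂ b₁ b₂ =
    ∑[ p < n ] ∑[ q < suc n ] ∑[ r < suc n ] ∑[ s < n ]
      term (p , q) (r , s)
    where
    term : White n → Black n → Carrier
    term x y = φ (L x y)
      * w₁ ^ proj₁ (whitePos x) * w₂ ^ proj₂ (whitePos x)
      * b₁ ^ proj₁ (blackPos y) * b₂ ^ proj₂ (blackPos y)

  -- Truncated subtraction in 2n-1 is harmless for n ≥ 1.
  module Corners (n : ℕ) (w₁ w₂ b₁ b₂ w₁⁻¹ b₂⁻¹ : Carrier) where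
    private
      2n 2n-1 : ℕ
      2n   = 2 ℕ.* n
      2n-1 = 2 ℕ.* n ℕ.∸ 1

    F⁰⁰ F⁰¹ F¹⁰ F¹¹ : Carrier
    F⁰⁰ = F n (w₁ ^ 2) (b₂ ^ 2) * w₁ * b₂
    F⁰¹ = F n (- (w₁⁻¹ ^ 2)) (- (b₂ ^ 2)) * w₁ ^ 2n-1 * b₁ ^ 2n * b₂ * i
    F¹⁰ = F n (- (w₁ ^ 2)) (- (b₂⁻¹ ^ 2)) * w₁ * w₂ ^ 2n * b₂ ^ 2n-1 * i
    F¹¹ = F n (w₁⁻¹ ^ 2) (b₂⁻¹ ^ 2)
            * w₁ ^ 2n-1 * w₂ ^ 2n * b₁ ^ 2n * b₂ ^ 2n-1

module Submission where

open import Defs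
open import Algebra.Bundles using (CommutativeRing)
open import Algebra.Morphism.Structures using (IsRingHomomorphism)
open import Data.Nat.Base as ℕ using (ℕ; zero; suc; _≤_; _<_; _≥_; z≤n; s≤s; _≡ᵇ_)
open import Data.Product.Base using (Σ; _×_; _,_)
import Algebra.Properties.Semiring.Exp
import Algebra.Construct.Pointwise as Pointwise
import Algebra.Morphism.Construct.Identity as Identity
import Algebra.Solver.Ring.NaturalCoefficients.Default as Solver
open import Data.Bool.Base using (Bool; true; false; if_then_else_; _∧_; _∨_)
open import Data.Fin.Base using (Fin; toℕ)
import Data.Fin.Properties as Fin
open import Data.Integer.Base as ℤ using (ℤ; +_; 1ℤ; -1ℤ)
import Data.Integer.Properties as ℤ
import Data.Integer.Tactic.RingSolver as ℤ-Solver
import Data.Nat.Properties as ℕ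
open import Data.Product.Properties using (×-≡,≡→≡; ×-≡,≡←≡)
open import Function.Base using (_∘_; id)
open import Function.Bundles using (_⇔_; mk⇔; module Equivalence)
open import Function.Construct.Composition using (_⇔-∘_)
open import Level using (_⊔_)
open import Relation.Binary.PropositionalEquality.Core as ≡ using (_≡_; cong; cong₂)
open import Relation.Nullary.Decidable using (does; does-⇔; _×-dec_)
open import Relation.Nullary.Negation using (contradiction)

-- K acts on Laurent polynomials as truncated multiplication by
-- (α + v β) / v, where α = 1 + i u, β = i + u, and u, v stand for w₁², w₂²;
-- transposed, it is truncated multiplication by (γ + s δ) / s, where
-- γ = 1 + i t, δ = i + t, and s, t stand for b₁², b₂².  Hence K⁻¹ has to be
-- given by polynomials Q j k in u and t with
--   α Q (j+1) k + β Q j k = t^j u^k = γ Q j (k+1) + δ Q j k,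
-- and these are solved by
--   Q j k = (t^j u^k − (−β)^j α^(n−j) (−δ)^k γ^(n−k) / 2^n) / (α t + β).
-- The division is exact: the two products in the numerator can be matched
-- factor by factor so that each difference of factors is a constant multiple
-- of α t + β.  Summing the two recurrences against v^j s^k telescopes, which
-- expresses G through the corners Q 0 0, Q 0 n, Q n 0, Q n n; these are
-- geometric sums.

-- The two recurrences share a denominator: α t + β = γ u + δ. On the curve where it vanishes, t =
-- -β/α, u = -δ/γ and α γ = 2, so (αγ/2)^n (-β/α)^j (-δ/γ)^k equals t^j u^k there; this is what
-- fixes the factor 1/2^n. The total exponent n keeps the homogeneous term a polynomial of degree at
-- most n in each variable, so the quotient has degree below n in both. These are exactly the
-- exponents of u and t that the graph provides, which is why the boundary of the diamond does no
-- harm. The obstacle is that Q is needed in two rings: over formal u and t, where its coefficients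
-- are the entries of K⁻¹, and in the arbitrary algebra A, where G lives and α t + β need not be
-- invertible. Hence Q is a division-free recursion that makes sense over every coefficient ring,
-- run once in R[[u]][[t]] and once in A. Formal power series make coefficient extraction immediate
-- but cannot be evaluated, so the two runs are tied together by a relation that carries degree
-- bounds along with the value.

-- Formal power series over a commutative ring

module FormalPowerSeries {c ℓ} (R : CommutativeRing c ℓ) where
  open CommutativeRing R
  open import Relation.Binary.Reasoning.Setoid setoid
  open Solver commutativeSemiring using (solve; _:+_; _:*_; _:=_)

  infixl 7 _⊛_
  infixl 6 _⊕_
  infix  4 _≋_

  PowerSeries : Set c
  PowerSeries = ℕ → Carrier

  _≋_ : PowerSeries → PowerSeries → Set ℓ
  f ≋ g = ∀ n → f n ≈ g n

  const : Carrier → PowerSeries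
  const a zero    = a
  const a (suc _) = 0#

  shift : PowerSeries → PowerSeries
  shift f zero    = 0#
  shift f (suc n) = f n

  X : PowerSeries
  X = shift (const 1#)

  -- The Cauchy product, obtained from f = f 0 + X f′. The ring laws then go by recursion on the
  -- degree, with f generalised to its tail `f ∘ suc`.
  _⊛_ : PowerSeries → PowerSeries → PowerSeries
  (f ⊛ g) zero    = f 0 * g 0
  (f ⊛ g) (suc n) = f 0 * g (suc n) + (f ∘ suc ⊛ g) n

  _⊕_ : PowerSeries → PowerSeries → PowerSeries
  (f ⊕ g) n = f n + g n

  ⊛-cong : ∀ {f f′ g g′} → f ≋ f′ → g ≋ g′ → f ⊛ g ≋ f′ ⊛ g′
  ⊛-cong p q zero    = *-cong (p 0) (q 0)
  ⊛-cong p q (suc n) = +-cong (*-cong (p 0) (q (suc n))) (⊛-cong (p ∘ suc) q n)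

  ⊛-zeroˡ : ∀ f → (λ _ → 0#) ⊛ f ≋ λ _ → 0#
  ⊛-zeroˡ f zero    = zeroˡ _
  ⊛-zeroˡ f (suc n) = trans (+-cong (zeroˡ _) (⊛-zeroˡ f n)) (+-identityʳ _)

  ⊛-distribʳ : ∀ f g h → (g ⊕ h) ⊛ f ≋ (g ⊛ f) ⊕ (h ⊛ f)
  ⊛-distribʳ f g h zero    = distribʳ _ _ _
  ⊛-distribʳ f g h (suc n) = begin
    (g 0 + h 0) * f (suc n) + ((g ∘ suc ⊕ h ∘ suc) ⊛ f) n
      ≈⟨ +-congˡ (⊛-distribʳ f (g ∘ suc) (h ∘ suc) n) ⟩
    (g 0 + h 0) * f (suc n) + ((g ∘ suc ⊛ f) n + (h ∘ suc ⊛ f) n)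
      ≈⟨ solve 5 (λ a b x p q → (a :+ b) :* x :+ (p :+ q) := (a :* x :+ p) :+ (b :* x :+ q)) refl _ _ _ _ _ ⟩
    (g ⊛ f) (suc n) + (h ⊛ f) (suc n) ∎

  -- The mirror image of the defining recursion, peeling the second factor; commutativity comes from
  -- matching the two.
  ⊛-sucʳ : ∀ f g n → (f ⊛ g) (suc n) ≈ f (suc n) * g 0 + (f ⊛ g ∘ suc) n
  ⊛-sucʳ f g zero    = +-comm _ _
  ⊛-sucʳ f g (suc n) = begin
    f 0 * g (2 ℕ.+ n) + (f ∘ suc ⊛ g) (suc n)
      ≈⟨ +-congˡ (⊛-sucʳ (f ∘ suc) g n) ⟩
    f 0 * g (2 ℕ.+ n) + (f (2 ℕ.+ n) * g 0 + (f ∘ suc ⊛ g ∘ suc) n)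
      ≈⟨ solve 3 (λ a b x → a :+ (b :+ x) := b :+ (a :+ x)) refl _ _ _ ⟩
    f (2 ℕ.+ n) * g 0 + (f 0 * g (2 ℕ.+ n) + (f ∘ suc ⊛ g ∘ suc) n) ∎

  ⊛-comm : ∀ f g → f ⊛ g ≋ g ⊛ f
  ⊛-comm f g zero    = *-comm _ _
  ⊛-comm f g (suc n) = begin
    f 0 * g (suc n) + (f ∘ suc ⊛ g) n  ≈⟨ +-cong (*-comm _ _) (⊛-comm (f ∘ suc) g n) ⟩
    g (suc n) * f 0 + (g ⊛ f ∘ suc) n  ≈⟨ ⊛-sucʳ g f n ⟨
    (g ⊛ f) (suc n) ∎

  ⊛-scaleˡ : ∀ a f g n → ((λ m → a * f m) ⊛ g) n ≈ a * (f ⊛ g) n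
  ⊛-scaleˡ a f g zero    = *-assoc _ _ _
  ⊛-scaleˡ a f g (suc n) = trans (+-cong (*-assoc _ _ _) (⊛-scaleˡ a (f ∘ suc) g n)) (sym (distribˡ _ _ _))

  ⊛-assoc : ∀ f g h → (f ⊛ g) ⊛ h ≋ f ⊛ (g ⊛ h)
  ⊛-assoc f g h zero    = *-assoc _ _ _
  ⊛-assoc f g h (suc n) = begin
    f 0 * g 0 * h (suc n) + (((λ m → f 0 * g (suc m)) ⊕ (f ∘ suc ⊛ g)) ⊛ h) n
      ≈⟨ +-congˡ (⊛-distribʳ h (λ m → f 0 * g (suc m)) (f ∘ suc ⊛ g) n) ⟩
    f 0 * g 0 * h (suc n) + (((λ m → f 0 * g (suc m)) ⊛ h) n + ((f ∘ suc ⊛ g) ⊛ h) n)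
      ≈⟨ +-congˡ (+-cong (⊛-scaleˡ (f 0) (g ∘ suc) h n) (⊛-assoc (f ∘ suc) g h n)) ⟩
    f 0 * g 0 * h (suc n) + (f 0 * (g ∘ suc ⊛ h) n + (f ∘ suc ⊛ (g ⊛ h)) n)
      ≈⟨ solve 5 (λ a b c d e → a :* b :* c :+ (a :* d :+ e) := a :* (b :* c :+ d) :+ e) refl _ _ _ _ _ ⟩
    f 0 * (g ⊛ h) (suc n) + (f ∘ suc ⊛ (g ⊛ h)) n ∎

  const-⊛ : ∀ a f n → (const a ⊛ f) n ≈ a * f n
  const-⊛ a f zero    = refl
  const-⊛ a f (suc n) = trans (+-congˡ (⊛-zeroˡ f n)) (+-identityʳ _)

  X-⊛ : ∀ f → X ⊛ f ≋ shift f
  X-⊛ f zero    = zeroˡ _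
  X-⊛ f (suc n) = begin
    0# * f (suc n) + (const 1# ⊛ f) n  ≈⟨ +-cong (zeroˡ _) (const-⊛ 1# f n) ⟩
    0# + 1# * f n                      ≈⟨ trans (+-identityˡ _) (*-identityˡ _) ⟩
    f n ∎

  powerSeriesRing : CommutativeRing c ℓ
  powerSeriesRing = record
    { Carrier = PowerSeries
    ; _≈_ = _≋_
    ; _+_ = _⊕_
    ; _*_ = _⊛_
    ; -_ = λ f n → - f n
    ; 0# = λ _ → 0#
    ; 1# = const 1#
    ; isCommutativeRing = record
      { isRing = record
        { +-isAbelianGroup = Pointwise.isAbelianGroup ℕ +-isAbelianGroup
        ; *-cong = ⊛-cong
        ; *-assoc = ⊛-assoc
        ; *-identity = identityˡ , λ f n → trans (⊛-comm f (const 1#) n) (identityˡ f n)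
        ; distrib = distrib′ , ⊛-distribʳ
        }
      ; *-comm = ⊛-comm
      }
    }
    where
    identityˡ : ∀ f → const 1# ⊛ f ≋ f
    identityˡ f n = trans (const-⊛ 1# f n) (*-identityˡ _)
    distrib′ : ∀ f g h → f ⊛ (g ⊕ h) ≋ (f ⊛ g) ⊕ (f ⊛ h)
    distrib′ f g h n = begin
      (f ⊛ (g ⊕ h)) n        ≈⟨ ⊛-comm f (g ⊕ h) n ⟩
      ((g ⊕ h) ⊛ f) n        ≈⟨ ⊛-distribʳ f g h n ⟩
      (g ⊛ f) n + (h ⊛ f) n  ≈⟨ +-cong (⊛-comm g f n) (⊛-comm h f n) ⟩
      (f ⊛ g) n + (f ⊛ h) n  ∎

module _ {c ℓ} (R : CoefficientRing c ℓ) where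
  open CoefficientRing R
  open FormalPowerSeries commutativeRing

  -- Coefficient rings are closed under adjoining a variable. Applied twice, this gives R[[u]][[t]],
  -- where `Q` can be formed with formal u and t.
  powerSeries : CoefficientRing c ℓ
  powerSeries = record
    { commutativeRing = powerSeriesRing
    ; 𝕚 = const 𝕚
    ; ½ = const ½
    ; 𝕚*𝕚 = λ { zero → 𝕚*𝕚 ; (suc n) → 𝕚-suc n }
    ; ½+½ = λ { zero → ½+½ ; (suc n) → +-identityʳ 0# }
    }
    where
    open import Algebra.Properties.Ring ring using (-0#≈0#)
    𝕚-suc : ∀ n → (const 𝕚 ⊛ const 𝕚) (suc n) ≈ - 0#
    𝕚-suc n = trans (const-⊛ 𝕚 (const 𝕚) (suc n)) (trans (zeroʳ _) (sym -0#≈0#))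

-- Exact quotients and their two recurrences

-- Throughout, 𝕚 * 𝕚 replaces -1, so that the identities below are semiring
-- identities up to a multiple of 1 + 𝕚 * 𝕚.
module Quotient {c ℓ} (R : CoefficientRing c ℓ) where
  open CoefficientRing R
  open import Algebra.Properties.Ring ring using (-1*x≈-x; -‿involutive)
  open import Algebra.Properties.Semiring.Exp semiring using (_^_)
  open import Relation.Binary.Reasoning.Setoid setoid
  open Solver commutativeSemiring using (solve; _:+_; _:*_; _:=_; con)

  1+𝕚*𝕚≈0 : 1# + 𝕚 * 𝕚 ≈ 0#
  1+𝕚*𝕚≈0 = trans (+-congˡ 𝕚*𝕚) (-‿inverseʳ 1#)

  𝕚*𝕚*x≈-x : ∀ x → 𝕚 * (𝕚 * x) ≈ - x
  𝕚*𝕚*x≈-x x = begin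
    𝕚 * (𝕚 * x)  ≈⟨ *-assoc 𝕚 𝕚 x ⟨
    𝕚 * 𝕚 * x    ≈⟨ *-congʳ 𝕚*𝕚 ⟩
    - 1# * x     ≈⟨ -1*x≈-x x ⟩
    - x          ∎

  𝕚⁴*x≈x : ∀ x → 𝕚 * (𝕚 * (𝕚 * (𝕚 * x))) ≈ x
  𝕚⁴*x≈x x = trans (𝕚*𝕚*x≈-x _) (trans (-‿cong (𝕚*𝕚*x≈-x x)) (-‿involutive x))

  -- The normal form in which every recurrence check ends. The solver sees 𝕚 and ½ as free
  -- variables, so the target x surfaces once plainly and once multiplied by 𝕚⁴, each with weight ½,
  -- beside a multiple of 1 + 𝕚².
  p+½[x+𝕚⁴x]≈x : ∀ p x → (1# + 𝕚 * 𝕚) * p + ½ * (x + 𝕚 * (𝕚 * (𝕚 * (𝕚 * x)))) ≈ x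
  p+½[x+𝕚⁴x]≈x p x = begin
    (1# + 𝕚 * 𝕚) * p + ½ * (x + 𝕚 * (𝕚 * (𝕚 * (𝕚 * x))))
      ≈⟨ +-cong (trans (*-congʳ 1+𝕚*𝕚≈0) (zeroˡ p)) (*-congˡ (+-congˡ (𝕚⁴*x≈x x))) ⟩
    0# + ½ * (x + x)  ≈⟨ solve 2 (λ h x → con 0 :+ h :* (x :+ x) := (h :+ h) :* x) refl ½ x ⟩
    (½ + ½) * x       ≈⟨ *-congʳ ½+½ ⟩
    1# * x            ≈⟨ *-identityˡ x ⟩
    x                 ∎

  module Bivariate (u t : Carrier) where
    α β γ δ κ z y y′ q : Carrier
    α  = 1# + 𝕚 * u
    β  = 𝕚 + u
    γ  = 1# + 𝕚 * t
    δ  = 𝕚 + t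
    κ  = 𝕚 * (𝕚 * (𝕚 * ½))
    z  = ½ * (α * γ)
    y  = 𝕚 * (𝕚 * (½ * (β * γ)))
    y′ = 𝕚 * (𝕚 * (½ * (α * δ)))
    q  = ½ * (β * δ)

    -- Q n j k is the exact quotient for j , k ≤ n.  Each step splits off one
    -- pair of factors p ∈ {z , y , y′ , q}, matched with τ ∈ {1 , t , u , t u}:
    -- τ − p = κ (α t + β) for z and q, and ½ (α t + β) for y and y′, and
    -- τ T − p P = (τ − p) T + p (T − P).
    Q : (n j k : ℕ) → Carrier
    Q zero    _       _       = 0#
    Q (suc n) zero    zero    = κ + z * Q n 0 0
    Q (suc n) zero    (suc k) = ½ * u ^ k + y′ * Q n 0 k
    Q (suc n) (suc j) zero    = ½ * t ^ j + y * Q n j 0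
    Q (suc n) (suc j) (suc k) = κ * (t ^ j * u ^ k) + q * Q n j k

    -- These expansions reduce multiplication by the constants above to sums, scalings and
    -- multiplications by u or t, the operations whose effect on coefficients and on degrees is
    -- known.
    α-* : ∀ x → α * x ≈ x + 𝕚 * (u * x)
    α-* = solve 3 (λ i u x → (con 1 :+ i :* u) :* x := x :+ i :* (u :* x)) refl 𝕚 u

    β-* : ∀ x → β * x ≈ 𝕚 * x + u * x
    β-* x = distribʳ x 𝕚 u

    γ-* : ∀ x → γ * x ≈ x + 𝕚 * (t * x)
    γ-* = solve 3 (λ i t x → (con 1 :+ i :* t) :* x := x :+ i :* (t :* x)) refl 𝕚 t

    δ-* : ∀ x → δ * x ≈ 𝕚 * x + t * x
    δ-* x = distribʳ x 𝕚 t

    ½-*-* : ∀ a b x → ½ * (a * b) * x ≈ ½ * (a * (b * x))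
    ½-*-* = solve 4 (λ h a b x → h :* (a :* b) :* x := h :* (a :* (b :* x))) refl ½

    𝕚𝕚½-*-* : ∀ a b x → 𝕚 * (𝕚 * (½ * (a * b))) * x ≈ 𝕚 * (𝕚 * (½ * (a * (b * x))))
    𝕚𝕚½-*-* = solve 5 (λ i h a b x → i :* (i :* (h :* (a :* b))) :* x := i :* (i :* (h :* (a :* (b :* x))))) refl 𝕚 ½

    κ-* : ∀ x → κ * x ≈ 𝕚 * (𝕚 * (𝕚 * (½ * x)))
    κ-* = solve 3 (λ i h x → i :* (i :* (i :* h)) :* x := i :* (i :* (i :* (h :* x)))) refl 𝕚 ½

    -- For j = 0 the two entries split off different factors, and their tails cancel outright
    -- because α y + β z = 0 and α q + β y′ = 0. For j > 0 both split off the same factor p, so the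
    -- induction hypothesis applies behind p and what is left is (τ - p) T + p T = τ T. The bound j
    -- < n guarantees a layer at which the factor -β replaces α.
    Q-recurrence : ∀ {n j} k → j < n → α * Q n (suc j) k + β * Q n j k ≈ t ^ j * u ^ k
    Q-recurrence {suc n} {zero} zero _ = begin
      α * (½ * 1# + y * Q n 0 0) + β * (κ + z * Q n 0 0)
        ≈⟨ solve 5 (λ i h u t Q →
             let α = con 1 :+ i :* u ; β = i :+ u ; γ = con 1 :+ i :* t in
             α :* (h :* con 1 :+ i :* (i :* (h :* (β :* γ))) :* Q) :+ β :* (i :* (i :* (i :* h)) :+ h :* (α :* γ) :* Q)
             := (con 1 :+ i :* i) :* (h :* (i :* u) :+ h :* (α :* (β :* γ)) :* Q)
                :+ h :* (con 1 :* con 1 :+ i :* (i :* (i :* (i :* (con 1 :* con 1)))))) refl 𝕚 ½ u t (Q n 0 0) ⟩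
      _ ≈⟨ p+½[x+𝕚⁴x]≈x _ (1# * 1#) ⟩
      1# * 1# ∎
    Q-recurrence {suc n} {zero} (suc k) _ = begin
      α * (κ * (1# * u ^ k) + q * Q n 0 k) + β * (½ * u ^ k + y′ * Q n 0 k)
        ≈⟨ solve 6 (λ i h u t U Q →
             let α = con 1 :+ i :* u ; β = i :+ u ; δ = i :+ t ; X = con 1 :* (u :* U) in
             α :* (i :* (i :* (i :* h)) :* (con 1 :* U) :+ h :* (β :* δ) :* Q)
               :+ β :* (h :* U :+ i :* (i :* (h :* (α :* δ))) :* Q)
             := (con 1 :+ i :* i) :* (h :* (i :* U) :+ h :* (α :* (β :* δ)) :* Q)
                :+ h :* (X :+ i :* (i :* (i :* (i :* X))))) refl 𝕚 ½ u t (u ^ k) (Q n 0 k) ⟩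
      _ ≈⟨ p+½[x+𝕚⁴x]≈x _ (1# * (u * u ^ k)) ⟩
      1# * (u * u ^ k) ∎
    Q-recurrence {suc n} {suc j} zero (s≤s j<n) = begin
      α * (½ * (t * t ^ j) + y * Q n (suc j) 0) + β * (½ * t ^ j + y * Q n j 0)
        ≈⟨ solve 8 (λ α β y h t T Q Q′ →
             α :* (h :* (t :* T) :+ y :* Q) :+ β :* (h :* T :+ y :* Q′)
             := h :* ((α :* t :+ β) :* T) :+ y :* (α :* Q :+ β :* Q′)) refl α β y ½ t (t ^ j) _ _ ⟩
      ½ * ((α * t + β) * t ^ j) + y * (α * Q n (suc j) 0 + β * Q n j 0)
        ≈⟨ +-congˡ (*-congˡ (Q-recurrence 0 j<n)) ⟩
      ½ * ((α * t + β) * t ^ j) + y * (t ^ j * 1#)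
        ≈⟨ solve 5 (λ i h u t T →
             let α = con 1 :+ i :* u ; β = i :+ u ; γ = con 1 :+ i :* t ; X = t :* T :* con 1 in
             h :* ((α :* t :+ β) :* T) :+ i :* (i :* (h :* (β :* γ))) :* (T :* con 1)
             := (con 1 :+ i :* i) :* (h :* β :* T :+ h :* (i :* u) :* (t :* T))
                :+ h :* (X :+ i :* (i :* (i :* (i :* X))))) refl 𝕚 ½ u t (t ^ j) ⟩
      _ ≈⟨ p+½[x+𝕚⁴x]≈x _ (t * t ^ j * 1#) ⟩
      t * t ^ j * 1# ∎
    Q-recurrence {suc n} {suc j} (suc k) (s≤s j<n) = begin
      α * (κ * (t * t ^ j * u ^ k) + q * Q n (suc j) k) + β * (κ * (t ^ j * u ^ k) + q * Q n j k)
        ≈⟨ solve 9 (λ α β q κ t T U Q Q′ →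
             α :* (κ :* (t :* T :* U) :+ q :* Q) :+ β :* (κ :* (T :* U) :+ q :* Q′)
             := κ :* ((α :* t :+ β) :* (T :* U)) :+ q :* (α :* Q :+ β :* Q′)) refl α β q κ t (t ^ j) (u ^ k) _ _ ⟩
      κ * ((α * t + β) * (t ^ j * u ^ k)) + q * (α * Q n (suc j) k + β * Q n j k)
        ≈⟨ +-congˡ (*-congˡ (Q-recurrence k j<n)) ⟩
      κ * ((α * t + β) * (t ^ j * u ^ k)) + q * (t ^ j * u ^ k)
        ≈⟨ solve 6 (λ i h u t T U →
             let α = con 1 :+ i :* u ; β = i :+ u ; δ = i :+ t ; X = t :* T :* (u :* U) in
             i :* (i :* (i :* h)) :* ((α :* t :+ β) :* (T :* U)) :+ h :* (β :* δ) :* (T :* U)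
             := (con 1 :+ i :* i) :* (h :* (i :* t :+ i :* u :+ i :* i) :* (T :* U))
                :+ h :* (X :+ i :* (i :* (i :* (i :* X))))) refl 𝕚 ½ u t (t ^ j) (u ^ k) ⟩
      _ ≈⟨ p+½[x+𝕚⁴x]≈x _ (t * t ^ j * (u * u ^ k)) ⟩
      t * t ^ j * (u * u ^ k) ∎

  open Bivariate using (Q; α; β; γ; δ)

  -- Exchanging u and t exchanges α with γ, β with δ and y with y′. This turns the recurrence in j
  -- into the one in k.
  Q-sym : ∀ u t n j k → Q u t n j k ≈ Q t u n k j
  Q-sym u t zero    j       k       = refl
  Q-sym u t (suc n) zero    zero    = +-congˡ (*-cong (*-congˡ (*-comm _ _)) (Q-sym u t n 0 0))
  Q-sym u t (suc n) zero    (suc k) = +-congˡ (*-cong (*-congˡ (*-congˡ (*-congˡ (*-comm _ _)))) (Q-sym u t n 0 k))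
  Q-sym u t (suc n) (suc j) zero    = +-congˡ (*-cong (*-congˡ (*-congˡ (*-congˡ (*-comm _ _)))) (Q-sym u t n j 0))
  Q-sym u t (suc n) (suc j) (suc k) =
    +-cong (*-congˡ (*-comm _ _)) (*-cong (*-congˡ (*-comm _ _)) (Q-sym u t n j k))

  Q-recurrenceʳ : ∀ u t {n} j {k} → k < n → γ u t * Q u t n j (suc k) + δ u t * Q u t n j k ≈ u ^ k * t ^ j
  Q-recurrenceʳ u t {n} j {k} k<n =
    trans (+-cong (*-congˡ (Q-sym u t n j (suc k))) (*-congˡ (Q-sym u t n j k))) (Bivariate.Q-recurrence t u j k<n)

-- Coefficients and values of polynomials in u and t

-- A series f in R[[u]][[t]] has outer variable t: f b a is the coefficient of
-- u^a t^b.
module Coefficients {c ℓ} (R : CoefficientRing c ℓ) where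
  private
    module U = FormalPowerSeries (CoefficientRing.commutativeRing R)
    module T = FormalPowerSeries U.powerSeriesRing
  open CoefficientRing R hiding (zero)

  coefficient-* : ∀ r f b a → (T.const (U.const r) T.⊛ f) b a ≈ r * f b a
  coefficient-* r f b a = trans (T.const-⊛ (U.const r) f b a) (U.const-⊛ r (f b) a)

  coefficient-u : ∀ f b a → (T.const U.X T.⊛ f) b a ≈ U.shift (f b) a
  coefficient-u f b a = trans (T.const-⊛ U.X f b a) (U.X-⊛ (f b) a)

  coefficient-t : ∀ f b a → (T.X T.⊛ f) b a ≈ T.shift f b a
  coefficient-t f b a = T.X-⊛ f b a

module Evaluation {c ℓ c′ ℓ′} (R : CoefficientRing c ℓ) (A : CommutativeRing c′ ℓ′)
                  (φ : CoefficientRing.Carrier R → CommutativeRing.Carrier A)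
                  (φ-hom : IsRingHomomorphism (CoefficientRing.rawRing R) (CommutativeRing.rawRing A) φ)
                  where
  private
    module R = CoefficientRing R
    module R[[u]] = CoefficientRing (powerSeries R)
    module R[[u]][[t]] = CoefficientRing (powerSeries (powerSeries R))
    module U = FormalPowerSeries R.commutativeRing
    module T = FormalPowerSeries R[[u]].commutativeRing
  open R[[u]][[t]] using () renaming (_≈_ to _≋_; _+_ to _⊕_; _*_ to _⊗_)
  open CommutativeRing A hiding (zero)
  open IsRingHomomorphism φ-hom
  open Coefficients R
  open import Algebra.Properties.Semiring.Exp semiring using (_^_)
  open import Algebra.Properties.Semiring.Sum semiring
    using (sum-syntax; sum-cong-≋; ∑-distrib-+; *-distribˡ-sum; sum-replicate-zero)
  open import Relation.Binary.Reasoning.Setoid setoid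
  open Solver commutativeSemiring using (solve; _:+_; _:*_; _:=_; con)

  -- Lets the recursion `Q` run at actual elements of A.
  extension : CoefficientRing c′ ℓ′
  extension = record
    { commutativeRing = A
    ; 𝕚 = φ R.𝕚
    ; ½ = φ R.½
    ; 𝕚*𝕚 = trans (sym (*-homo _ _)) (trans (⟦⟧-cong R.𝕚*𝕚) (trans (-‿homo _) (-‿cong 1#-homo)))
    ; ½+½ = trans (sym (+-homo _ _)) (trans (⟦⟧-cong R.½+½) 1#-homo)
    }

  ∑-zero : ∀ n {g : Fin n → Carrier} → (∀ i → g i ≈ 0#) → ∑[ i < n ] g i ≈ 0#
  ∑-zero n g≈0 = trans (sum-cong-≋ g≈0) (sum-replicate-zero n)

  module _ (u t : Carrier) where

    monomial : ℕ → ℕ → Carrier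
    monomial a b = u ^ a * t ^ b

    evaluate : (N M : ℕ) → R[[u]][[t]].Carrier → Carrier
    evaluate N M f = ∑[ a < N ] ∑[ b < M ] (φ (f (toℕ b) (toℕ a)) * monomial (toℕ a) (toℕ b))

    -- Evaluation as a relation: f is a polynomial of degree below N in u and below M in t, with
    -- value x. The bounds make the finite sum `evaluate` see all of f, and the relation is
    -- preserved by the operations from which `Q` is built.
    record Represents (N M : ℕ) (f : R[[u]][[t]].Carrier) (x : Carrier) : Set (ℓ ⊔ ℓ′) where
      field
        vanishesᵘ : ∀ b {a} → N ≤ a → f b a R.≈ R.0#
        vanishesᵗ : ∀ {b} a → M ≤ b → f b a R.≈ R.0#
        evaluates : evaluate N M f ≈ x
    open Represents

    term-cong : ∀ {r r′} m → r R.≈ r′ → φ r * m ≈ φ r′ * m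
    term-cong m r≈r′ = *-congʳ (⟦⟧-cong r≈r′)

    term-zero : ∀ {r} m → r R.≈ R.0# → φ r * m ≈ 0#
    term-zero m r≈0 = trans (term-cong m r≈0) (trans (*-congʳ 0#-homo) (zeroˡ m))

    evaluate-cong : ∀ N M {f g} → f ≋ g → evaluate N M f ≈ evaluate N M g
    evaluate-cong N M f≈g = sum-cong-≋ {N} λ a → sum-cong-≋ {M} λ b → term-cong _ (f≈g (toℕ b) (toℕ a))

    represents-resp : ∀ {N M f g x y} → f ≋ g → x ≈ y → Represents N M f x → Represents N M g y
    represents-resp {N} {M} f≈g x≈y F = record
      { vanishesᵘ = λ b N≤a → R.trans (R.sym (f≈g b _)) (vanishesᵘ F b N≤a)
      ; vanishesᵗ = λ a M≤b → R.trans (R.sym (f≈g _ a)) (vanishesᵗ F a M≤b)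
      ; evaluates = trans (evaluate-cong N M (λ b a → R.sym (f≈g b a))) (trans (evaluates F) x≈y)
      }

    represents-0 : Represents 0 0 R[[u]][[t]].0# 0#
    represents-0 = record { vanishesᵘ = λ _ _ → R.refl ; vanishesᵗ = λ _ _ → R.refl ; evaluates = refl }

    represents-1 : Represents 1 1 R[[u]][[t]].1# 1#
    represents-1 = record
      { vanishesᵘ = λ { zero (s≤s _) → R.refl ; (suc _) _ → R.refl }
      ; vanishesᵗ = λ { _ (s≤s _) → R.refl }
      ; evaluates = begin
          φ R.1# * (1# * 1#) + 0# + 0#  ≈⟨ +-congʳ (+-congʳ (*-congʳ 1#-homo)) ⟩
          1# * (1# * 1#) + 0# + 0#      ≈⟨ solve 0 (con 1 :* (con 1 :* con 1) :+ con 0 :+ con 0 := con 1) refl ⟩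
          1# ∎
      }

    represents-+ : ∀ {N M f g x y} → Represents N M f x → Represents N M g y →
                   Represents N M (f ⊕ g) (x + y)
    represents-+ {N} {M} {f} {g} {x} {y} F G = record
      { vanishesᵘ = λ b N≤a → R.trans (R.+-cong (vanishesᵘ F b N≤a) (vanishesᵘ G b N≤a)) (R.+-identityˡ _)
      ; vanishesᵗ = λ a M≤b → R.trans (R.+-cong (vanishesᵗ F a M≤b) (vanishesᵗ G a M≤b)) (R.+-identityˡ _)
      ; evaluates = begin
          evaluate N M (f ⊕ g)
            ≈⟨ sum-cong-≋ {N} (λ a → sum-cong-≋ {M} λ b → trans (*-congʳ (+-homo _ _)) (distribʳ _ _ _)) ⟩
          ∑[ a < N ] ∑[ b < M ] (F′ a b + G′ a b)
            ≈⟨ sum-cong-≋ {N} (λ a → ∑-distrib-+ {M} (F′ a) (G′ a)) ⟩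
          ∑[ a < N ] (∑[ b < M ] F′ a b + ∑[ b < M ] G′ a b)
            ≈⟨ ∑-distrib-+ {N} (λ a → ∑[ b < M ] F′ a b) (λ a → ∑[ b < M ] G′ a b) ⟩
          evaluate N M f + evaluate N M g
            ≈⟨ +-cong (evaluates F) (evaluates G) ⟩
          x + y ∎
      }
      where
      F′ G′ : Fin N → Fin M → Carrier
      F′ a b = φ (f (toℕ b) (toℕ a)) * monomial (toℕ a) (toℕ b)
      G′ a b = φ (g (toℕ b) (toℕ a)) * monomial (toℕ a) (toℕ b)

    ∑∑-scale : ∀ N M s (g : Fin N → Fin M → Carrier) →
               ∑[ a < N ] ∑[ b < M ] (s * g a b) ≈ s * (∑[ a < N ] ∑[ b < M ] g a b)
    ∑∑-scale N M s g = trans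
      (sum-cong-≋ {N} λ a → sym (*-distribˡ-sum {M} s (g a)))
      (sym (*-distribˡ-sum {N} s (λ a → ∑[ b < M ] g a b)))

    represents-scale : ∀ {N M f x} r → Represents N M f x →
                       Represents N M (T.const (U.const r) ⊗ f) (φ r * x)
    represents-scale {N} {M} {f} {x} r F = record
      { vanishesᵘ = λ b N≤a → R.trans (coefficient-* r f b _) (R.trans (R.*-congˡ (vanishesᵘ F b N≤a)) (R.zeroʳ r))
      ; vanishesᵗ = λ a M≤b → R.trans (coefficient-* r f _ a) (R.trans (R.*-congˡ (vanishesᵗ F a M≤b)) (R.zeroʳ r))
      ; evaluates = begin
          evaluate N M (T.const (U.const r) ⊗ f)
            ≈⟨ sum-cong-≋ {N} (λ a → sum-cong-≋ {M} λ b → trans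
                 (*-congʳ (trans (⟦⟧-cong (coefficient-* r f (toℕ b) (toℕ a))) (*-homo _ _))) (*-assoc _ _ _)) ⟩
          ∑[ a < N ] ∑[ b < M ] (φ r * (φ (f (toℕ b) (toℕ a)) * monomial (toℕ a) (toℕ b)))
            ≈⟨ ∑∑-scale N M (φ r) _ ⟩
          φ r * evaluate N M f
            ≈⟨ *-congˡ (evaluates F) ⟩
          φ r * x ∎
      }

    represents-u : ∀ {N M f x} → Represents N M f x → Represents (suc N) M (T.const U.X ⊗ f) (u * x)
    represents-u {N} {M} {f} {x} F = record
      { vanishesᵘ = λ { b {suc a} (s≤s N≤a) → R.trans (coefficient-u f b (suc a)) (vanishesᵘ F b N≤a) }
      ; vanishesᵗ = λ { {b} zero M≤b → coefficient-u f b zero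
                      ; {b} (suc a) M≤b → R.trans (coefficient-u f b (suc a)) (vanishesᵗ F a M≤b) }
      ; evaluates = begin
          evaluate (suc N) M (T.const U.X ⊗ f)
            ≈⟨ +-cong (∑-zero M (λ b → term-zero _ (coefficient-u f (toℕ b) 0)))
                      (sum-cong-≋ {N} λ a → sum-cong-≋ {M} λ b → trans
                         (term-cong _ (coefficient-u f (toℕ b) (suc (toℕ a))))
                         (solve 4 (λ x u U T → x :* (u :* U :* T) := u :* (x :* (U :* T))) refl _ u _ _)) ⟩
          0# + ∑[ a < N ] ∑[ b < M ] (u * (φ (f (toℕ b) (toℕ a)) * monomial (toℕ a) (toℕ b)))
            ≈⟨ trans (+-identityˡ _) (∑∑-scale N M u _) ⟩
          u * evaluate N M f
            ≈⟨ *-congˡ (evaluates F) ⟩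
          u * x ∎
      }

    represents-t : ∀ {N M f x} → Represents N M f x → Represents N (suc M) (T.X ⊗ f) (t * x)
    represents-t {N} {M} {f} {x} F = record
      { vanishesᵘ = λ { zero {a} N≤a → coefficient-t f zero a
                      ; (suc b) {a} N≤a → R.trans (coefficient-t f (suc b) a) (vanishesᵘ F b N≤a) }
      ; vanishesᵗ = λ { {suc b} a (s≤s M≤b) → R.trans (coefficient-t f (suc b) a) (vanishesᵗ F a M≤b) }
      ; evaluates = begin
          evaluate N (suc M) (T.X ⊗ f)
            ≈⟨ sum-cong-≋ {N} (λ a → trans
                 (+-cong (term-zero _ (coefficient-t f 0 (toℕ a)))
                         (sum-cong-≋ {M} λ b → trans
                            (term-cong _ (coefficient-t f (suc (toℕ b)) (toℕ a)))
                            (solve 4 (λ x t U T → x :* (U :* (t :* T)) := t :* (x :* (U :* T))) refl _ t _ _)))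
                 (+-identityˡ _)) ⟩
          ∑[ a < N ] ∑[ b < M ] (t * (φ (f (toℕ b) (toℕ a)) * monomial (toℕ a) (toℕ b)))
            ≈⟨ ∑∑-scale N M t _ ⟩
          t * evaluate N M f
            ≈⟨ *-congˡ (evaluates F) ⟩
          t * x ∎
      }

    ∑-snoc : ∀ n (g : ℕ → Carrier) → ∑[ i < suc n ] g (toℕ i) ≈ ∑[ i < n ] g (toℕ i) + g n
    ∑-snoc zero    g = +-comm _ _
    ∑-snoc (suc n) g = trans (+-congˡ (∑-snoc n (g ∘ suc))) (sym (+-assoc _ _ _))

    represents-widenᵘ : ∀ {N M f x} → Represents N M f x → Represents (suc N) M f x
    represents-widenᵘ {N} {M} {f} {x} F = record
      { vanishesᵘ = λ b N<a → vanishesᵘ F b (ℕ.<⇒≤ N<a)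
      ; vanishesᵗ = vanishesᵗ F
      ; evaluates = begin
          evaluate (suc N) M f
            ≈⟨ ∑-snoc N (λ a → ∑[ b < M ] (φ (f (toℕ b) a) * monomial a (toℕ b))) ⟩
          evaluate N M f + ∑[ b < M ] (φ (f (toℕ b) N) * monomial N (toℕ b))
            ≈⟨ +-cong (evaluates F) (∑-zero M λ b → term-zero _ (vanishesᵘ F (toℕ b) ℕ.≤-refl)) ⟩
          x + 0# ≈⟨ +-identityʳ x ⟩
          x ∎
      }

    represents-widenᵗ : ∀ {N M f x} → Represents N M f x → Represents N (suc M) f x
    represents-widenᵗ {N} {M} {f} {x} F = record
      { vanishesᵘ = vanishesᵘ F
      ; vanishesᵗ = λ a M<b → vanishesᵗ F a (ℕ.<⇒≤ M<b)
      ; evaluates = begin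
          evaluate N (suc M) f
            ≈⟨ sum-cong-≋ {N} (λ a → trans
                 (∑-snoc M (λ b → φ (f b (toℕ a)) * monomial (toℕ a) b))
                 (trans (+-congˡ (term-zero _ (vanishesᵗ F (toℕ a) ℕ.≤-refl))) (+-identityʳ _))) ⟩
          evaluate N M f ≈⟨ evaluates F ⟩
          x ∎
      }

    represents-≤ᵘ : ∀ {N N′ M f x} → N ℕ.≤′ N′ → Represents N M f x → Represents N′ M f x
    represents-≤ᵘ ℕ.≤′-refl     F = F
    represents-≤ᵘ (ℕ.≤′-step p) F = represents-widenᵘ (represents-≤ᵘ p F)

    represents-≤ᵗ : ∀ {N M M′ f x} → M ℕ.≤′ M′ → Represents N M f x → Represents N M′ f x
    represents-≤ᵗ ℕ.≤′-refl     F = F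
    represents-≤ᵗ (ℕ.≤′-step p) F = represents-widenᵗ (represents-≤ᵗ p F)

    open import Algebra.Properties.Semiring.Exp R[[u]][[t]].semiring using () renaming (_^_ to _^^_)

    represents-u^ : ∀ k → Represents (suc k) 1 (T.const U.X ^^ k) (u ^ k)
    represents-u^ zero    = represents-1
    represents-u^ (suc k) = represents-u (represents-u^ k)

    represents-t^u^ : ∀ j k → Represents (suc k) (suc j) (T.X ^^ j ⊗ T.const U.X ^^ k) (t ^ j * u ^ k)
    represents-t^u^ zero    k =
      represents-resp (R[[u]][[t]].sym (R[[u]][[t]].*-identityˡ (T.const U.X ^^ k))) (sym (*-identityˡ _)) (represents-u^ k)
    represents-t^u^ (suc j) k =
      represents-resp (R[[u]][[t]].sym (R[[u]][[t]].*-assoc T.X (T.X ^^ j) (T.const U.X ^^ k))) (sym (*-assoc _ _ _))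
        (represents-t (represents-t^u^ j k))

    private
      module S = Quotient.Bivariate (powerSeries (powerSeries R)) (T.const U.X) T.X
      module V = Quotient.Bivariate extension u t

    represents-𝕚 : ∀ {N M f x} → Represents N M f x → Represents N M (R[[u]][[t]].𝕚 ⊗ f) (φ R.𝕚 * x)
    represents-𝕚 = represents-scale R.𝕚

    represents-α : ∀ {N M f x} → Represents N M f x → Represents (suc N) M (S.α ⊗ f) (V.α * x)
    represents-α {f = f} {x} F = represents-resp (R[[u]][[t]].sym (S.α-* f)) (sym (V.α-* x))
      (represents-+ (represents-widenᵘ F) (represents-𝕚 (represents-u F)))

    represents-β : ∀ {N M f x} → Represents N M f x → Represents (suc N) M (S.β ⊗ f) (V.β * x)
    represents-β {f = f} {x} F = represents-resp (R[[u]][[t]].sym (S.β-* f)) (sym (V.β-* x))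
      (represents-+ (represents-widenᵘ (represents-𝕚 F)) (represents-u F))

    represents-γ : ∀ {N M f x} → Represents N M f x → Represents N (suc M) (S.γ ⊗ f) (V.γ * x)
    represents-γ {f = f} {x} F = represents-resp (R[[u]][[t]].sym (S.γ-* f)) (sym (V.γ-* x))
      (represents-+ (represents-widenᵗ F) (represents-𝕚 (represents-t F)))

    represents-δ : ∀ {N M f x} → Represents N M f x → Represents N (suc M) (S.δ ⊗ f) (V.δ * x)
    represents-δ {f = f} {x} F = represents-resp (R[[u]][[t]].sym (S.δ-* f)) (sym (V.δ-* x))
      (represents-+ (represents-widenᵗ (represents-𝕚 F)) (represents-t F))

    represents-½ : ∀ {N M f x} → Represents N M f x → Represents N M (R[[u]][[t]].½ ⊗ f) (φ R.½ * x)
    represents-½ = represents-scale R.½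

    represents-κ : ∀ {N M f x} → Represents N M f x → Represents N M (S.κ ⊗ f) (V.κ * x)
    represents-κ {f = f} {x} F = represents-resp (R[[u]][[t]].sym (S.κ-* f)) (sym (V.κ-* x))
      (represents-𝕚 (represents-𝕚 (represents-𝕚 (represents-½ F))))

    -- The hypothesis is the joint effect of two linear factors on bounds and value; this form
    -- serves both z and q, and the next one both y and y′.
    represents-½-*-* : ∀ {N N′ M M′ a b f x x₁ x₂} →
      (∀ {f x} → Represents N M f x → Represents N′ M′ (a ⊗ (b ⊗ f)) (x₁ * (x₂ * x))) →
      Represents N M f x → Represents N′ M′ (R[[u]][[t]].½ ⊗ (a ⊗ b) ⊗ f) (φ R.½ * (x₁ * x₂) * x)
    represents-½-*-* {a = a} {b} {f} {x} {x₁} {x₂} ab F =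
      represents-resp (R[[u]][[t]].sym (S.½-*-* a b f)) (sym (V.½-*-* x₁ x₂ x)) (represents-½ (ab F))

    represents-𝕚𝕚½-*-* : ∀ {N N′ M M′ a b f x x₁ x₂} →
      (∀ {f x} → Represents N M f x → Represents N′ M′ (a ⊗ (b ⊗ f)) (x₁ * (x₂ * x))) →
      Represents N M f x →
      Represents N′ M′ (R[[u]][[t]].𝕚 ⊗ (R[[u]][[t]].𝕚 ⊗ (R[[u]][[t]].½ ⊗ (a ⊗ b))) ⊗ f)
                       (φ R.𝕚 * (φ R.𝕚 * (φ R.½ * (x₁ * x₂))) * x)
    represents-𝕚𝕚½-*-* {a = a} {b} {f} {x} {x₁} {x₂} ab F =
      represents-resp (R[[u]][[t]].sym (S.𝕚𝕚½-*-* a b f)) (sym (V.𝕚𝕚½-*-* x₁ x₂ x))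
        (represents-𝕚 (represents-𝕚 (represents-½ (ab F))))

    -- Each of z, y, y′, q is a product of one linear factor in u and one in t, so a layer raises
    -- both bounds by one; the monomial it adds has exponents at most n, within the new bound suc n.
    represents-Q : ∀ {n j k} → j ≤ n → k ≤ n → Represents n n (S.Q n j k) (V.Q n j k)
    represents-Q {zero} z≤n z≤n = represents-0
    represents-Q {suc n} {zero} {zero} _ _ = represents-+
      (represents-resp (R[[u]][[t]].*-identityʳ S.κ) (*-identityʳ V.κ)
        (represents-≤ᵘ (ℕ.≤⇒≤′ (s≤s z≤n)) (represents-≤ᵗ (ℕ.≤⇒≤′ (s≤s z≤n)) (represents-κ represents-1))))
      (represents-½-*-* {a = S.α} {S.γ} (λ F → represents-α (represents-γ F)) (represents-Q z≤n z≤n))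
    represents-Q {suc n} {zero} {suc k} _ (s≤s k≤n) = represents-+
      (represents-½ (represents-≤ᵘ (ℕ.≤⇒≤′ (s≤s k≤n)) (represents-≤ᵗ (ℕ.≤⇒≤′ (s≤s z≤n)) (represents-u^ k))))
      (represents-𝕚𝕚½-*-* {a = S.α} {S.δ} (λ F → represents-α (represents-δ F)) (represents-Q z≤n k≤n))
    represents-Q {suc n} {suc j} {zero} (s≤s j≤n) _ = represents-+
      (represents-½ (represents-resp (R[[u]][[t]].*-identityʳ (T.X ^^ j)) (*-identityʳ (t ^ j))
        (represents-≤ᵘ (ℕ.≤⇒≤′ (s≤s z≤n)) (represents-≤ᵗ (ℕ.≤⇒≤′ (s≤s j≤n)) (represents-t^u^ j 0)))))
      (represents-𝕚𝕚½-*-* {a = S.β} {S.γ} (λ F → represents-β (represents-γ F)) (represents-Q j≤n z≤n))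
    represents-Q {suc n} {suc j} {suc k} (s≤s j≤n) (s≤s k≤n) = represents-+
      (represents-κ (represents-≤ᵘ (ℕ.≤⇒≤′ (s≤s k≤n)) (represents-≤ᵗ (ℕ.≤⇒≤′ (s≤s j≤n)) (represents-t^u^ j k))))
      (represents-½-*-* {a = S.β} {S.δ} (λ F → represents-β (represents-δ F)) (represents-Q j≤n k≤n))

-- Adjacency as equations between indices

≡ᵇ-comm : ∀ m n → (m ≡ᵇ n) ≡ (n ≡ᵇ m)
≡ᵇ-comm zero    zero    = ≡.refl
≡ᵇ-comm zero    (suc n) = ≡.refl
≡ᵇ-comm (suc m) zero    = ≡.refl
≡ᵇ-comm (suc m) (suc n) = ≡ᵇ-comm m n

≡ᵇ-suc-exclusive : ∀ m n → (m ≡ᵇ suc n) ∧ (m ≡ᵇ n) ≡ false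
≡ᵇ-suc-exclusive zero          n       = ≡.refl
≡ᵇ-suc-exclusive (suc zero)    zero    = ≡.refl
≡ᵇ-suc-exclusive (suc (suc m)) zero    = ≡.refl
≡ᵇ-suc-exclusive (suc m)       (suc n) = ≡ᵇ-suc-exclusive m n

difference≡1⇔ : ∀ a b → (+ a ℤ.- + b ≡ 1ℤ) ⇔ (a ≡ suc b)
difference≡1⇔ a b = mk⇔
  (λ eq → ℤ.+-injective (≡.trans (restore (+ a) (+ b)) (cong (ℤ._+ + b) eq)))
  (λ { ≡.refl → cancel (+ b) })
  where
  restore : ∀ x y → x ≡ x ℤ.- y ℤ.+ y
  restore = ℤ-Solver.solve-∀
  cancel : ∀ y → 1ℤ ℤ.+ y ℤ.- y ≡ 1ℤ
  cancel = ℤ-Solver.solve-∀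

difference≡-1⇔ : ∀ a b → (+ a ℤ.- + b ≡ -1ℤ) ⇔ (suc a ≡ b)
difference≡-1⇔ a b = mk⇔
  (λ eq → ≡.sym (to (≡.trans (swap (+ b) (+ a)) (cong ℤ.-_ eq))))
  (λ eq → ≡.trans (swap (+ a) (+ b)) (cong ℤ.-_ (from (≡.sym eq))))
  where
  open Equivalence (difference≡1⇔ b a)
  swap : ∀ x y → x ℤ.- y ≡ ℤ.- (y ℤ.- x)
  swap = ℤ-Solver.solve-∀

double⇔ : ∀ {a b} m n r → a ≡ r ℕ.+ 2 ℕ.* m → b ≡ r ℕ.+ 2 ℕ.* n → (a ≡ b) ⇔ (m ≡ n)
double⇔ m n r p q = mk⇔
  (λ a≡b → ℕ.*-cancelˡ-≡ m n 2 (ℕ.+-cancelˡ-≡ r _ _ (≡.trans (≡.sym p) (≡.trans a≡b q))))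
  (λ { ≡.refl → ≡.trans p (≡.sym q) })

2m+1≡1+2m : ∀ m → 2 ℕ.* m ℕ.+ 1 ≡ 1 ℕ.+ 2 ℕ.* m
2m+1≡1+2m m = ℕ.+-comm (2 ℕ.* m) 1

2+2m≡2[1+m] : ∀ m → 2 ℕ.+ 2 ℕ.* m ≡ 2 ℕ.* suc m
2+2m≡2[1+m] m = ≡.sym (ℕ.*-suc 2 m)

even-odd≡1⇔ : ∀ k i → (+ (2 ℕ.* k) ℤ.- + (2 ℕ.* i ℕ.+ 1) ≡ 1ℤ) ⇔ (k ≡ suc i)
even-odd≡1⇔ k i =
  double⇔ k (suc i) 0 ≡.refl (≡.trans (cong suc (2m+1≡1+2m i)) (2+2m≡2[1+m] i)) ⇔-∘ difference≡1⇔ _ _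

even-odd≡-1⇔ : ∀ k i → (+ (2 ℕ.* k) ℤ.- + (2 ℕ.* i ℕ.+ 1) ≡ -1ℤ) ⇔ (k ≡ i)
even-odd≡-1⇔ k i =
  double⇔ k i 1 ≡.refl (2m+1≡1+2m i) ⇔-∘ difference≡-1⇔ _ _

odd-even≡1⇔ : ∀ l j → (+ (2 ℕ.* l ℕ.+ 1) ℤ.- + (2 ℕ.* j) ≡ 1ℤ) ⇔ (l ≡ j)
odd-even≡1⇔ l j =
  double⇔ l j 1 (2m+1≡1+2m l) ≡.refl ⇔-∘ difference≡1⇔ _ _

odd-even≡-1⇔ : ∀ l j → (+ (2 ℕ.* l ℕ.+ 1) ℤ.- + (2 ℕ.* j) ≡ -1ℤ) ⇔ (suc l ≡ j)
odd-even≡-1⇔ l j =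
  double⇔ (suc l) j 0 (≡.trans (cong suc (2m+1≡1+2m l)) (2+2m≡2[1+m] l)) ≡.refl ⇔-∘ difference≡-1⇔ _ _

-- The right side is what `does` computes to for the corresponding decision on ℕ, so the integer
-- comparisons in `K` become Boolean tests that sums over indices can consume.
does-≟² : ∀ {x y x′ y′ : ℤ} {k i l j : ℕ} → (x ≡ x′) ⇔ (k ≡ i) → (y ≡ y′) ⇔ (l ≡ j) →
          does ((x , y) ≟² (x′ , y′)) ≡ (k ≡ᵇ i) ∧ (l ≡ᵇ j)
does-≟² {x} {y} {x′} {y′} {k} {i} {l} {j} f g = does-⇔
  (mk⇔ (λ eq → let p , q = ×-≡,≡←≡ eq in Equivalence.to f p , Equivalence.to g q)
       (λ (p , q) → cong₂ _,_ (Equivalence.from f p) (Equivalence.from g q)))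
  ((x , y) ≟² (x′ , y′)) (k ℕ.≟ i ×-dec l ℕ.≟ j)

does-≟-Fin² : ∀ {m n} (k k′ : Fin m) (l l′ : Fin n) (eq? : _) →
              does {A = (k , l) ≡ (k′ , l′)} eq? ≡ (toℕ k ≡ᵇ toℕ k′) ∧ (toℕ l ≡ᵇ toℕ l′)
does-≟-Fin² k k′ l l′ eq? = does-⇔
  (mk⇔ (λ { ≡.refl → ≡.refl , ≡.refl })
       (λ (p , q) → cong₂ _,_ (Fin.toℕ-injective p) (Fin.toℕ-injective q)))
  eq? (toℕ k ℕ.≟ toℕ k′ ×-dec toℕ l ℕ.≟ toℕ l′)

-- The inverse Kasteleyn matrix

module Inverse {c ℓ} (R : CoefficientRing c ℓ) (n : ℕ) where
  open CoefficientRing R hiding (zero)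
  open Kasteleyn R n
  open Coefficients R
  open import Algebra.Properties.Semiring.Sum semiring
    using (sum-syntax; sum-cong-≋; ∑-distrib-+; ∑-comm; sum-replicate-zero)
  open import Relation.Binary.Reasoning.Setoid setoid
  open Solver commutativeSemiring using (solve; _:+_; _:*_; _:=_; con)
  private
    module R[[u]] = CoefficientRing (powerSeries R)
    module R[[u]][[t]] = CoefficientRing (powerSeries (powerSeries R))
    module U = FormalPowerSeries commutativeRing
    module T = FormalPowerSeries R[[u]].commutativeRing
    module S = Quotient.Bivariate (powerSeries (powerSeries R)) (T.const U.X) T.X
  open U using (shift)
  open R[[u]][[t]] using () renaming (_≈_ to _≋_; _+_ to _⊕_; _*_ to _⊗_)
  open import Algebra.Properties.Semiring.Exp R[[u]][[t]].semiring using (_^_)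

  𝟙 : Bool → Carrier
  𝟙 p = if p then 1# else 0#

  𝟙-∧ : ∀ p q → 𝟙 (p ∧ q) ≈ 𝟙 p * 𝟙 q
  𝟙-∧ false q = sym (zeroˡ _)
  𝟙-∧ true  q = sym (*-identityˡ _)

  coefficient-u^ : ∀ k b a → (T.const U.X ^ k) b a ≈ 𝟙 (0 ≡ᵇ b) * 𝟙 (k ≡ᵇ a)
  coefficient-u^ zero    zero    zero    = sym (*-identityˡ _)
  coefficient-u^ zero    zero    (suc a) = sym (*-identityˡ _)
  coefficient-u^ zero    (suc b) a       = sym (zeroˡ _)
  coefficient-u^ (suc k) b       zero    = trans (coefficient-u (T.const U.X ^ k) b 0) (sym (zeroʳ _))
  coefficient-u^ (suc k) b       (suc a) = trans (coefficient-u (T.const U.X ^ k) b (suc a)) (coefficient-u^ k b a)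

  coefficient-t^u^ : ∀ j k b a → (T.X ^ j ⊗ T.const U.X ^ k) b a ≈ 𝟙 (j ≡ᵇ b) * 𝟙 (k ≡ᵇ a)
  coefficient-t^u^ zero    k b a =
    trans (R[[u]][[t]].*-identityˡ (T.const U.X ^ k) b a) (coefficient-u^ k b a)
  coefficient-t^u^ (suc j) k b a =
    trans (R[[u]][[t]].*-assoc T.X (T.X ^ j) (T.const U.X ^ k) b a)
      (trans (coefficient-t (T.X ^ j ⊗ T.const U.X ^ k) b a) (case b))
    where
    case : ∀ b → T.shift (T.X ^ j ⊗ T.const U.X ^ k) b a ≈ 𝟙 (suc j ≡ᵇ b) * 𝟙 (k ≡ᵇ a)
    case zero    = sym (zeroˡ _)
    case (suc b) = coefficient-t^u^ j k b a

  coefficient-α-β : ∀ f g b a → (S.α ⊗ f ⊕ S.β ⊗ g) b a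
                              ≈ (f b a + 𝕚 * shift (f b) a) + (𝕚 * g b a + shift (g b) a)
  coefficient-α-β f g b a = +-cong
    (trans (S.α-* f b a) (+-congˡ (trans (coefficient-* 𝕚 (T.const U.X ⊗ f) b a) (*-congˡ (coefficient-u f b a)))))
    (trans (S.β-* g b a) (+-cong (coefficient-* 𝕚 g b a) (coefficient-u g b a)))

  shift-t : ∀ f b a → T.shift f b a ≈ shift (λ m → f m a) b
  shift-t f zero    a = refl
  shift-t f (suc b) a = refl

  coefficient-γ-δ : ∀ f g b a → (S.γ ⊗ f ⊕ S.δ ⊗ g) b a
                              ≈ (f b a + 𝕚 * shift (λ m → f m a) b) + (𝕚 * g b a + shift (λ m → g m a) b)
  coefficient-γ-δ f g b a = +-cong
    (trans (S.γ-* f b a) (+-congˡ (trans (coefficient-* 𝕚 (T.X ⊗ f) b a)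
      (*-congˡ (trans (coefficient-t f b a) (shift-t f b a))))))
    (trans (S.δ-* g b a) (+-cong (coefficient-* 𝕚 g b a) (trans (coefficient-t g b a) (shift-t g b a))))

  -- When k lies outside the range, the left side is zero and the hypothesis makes the right side
  -- zero too. The degree bounds of `Q` enter here, absorbing the truncation at the boundary.
  ∑-𝟙 : ∀ m k (g : ℕ → Carrier) → (m ≤ k → g k ≈ 0#) → ∑[ i < m ] (𝟙 (k ≡ᵇ toℕ i) * g (toℕ i)) ≈ g k
  ∑-𝟙 zero    k       g g≈0 = sym (g≈0 z≤n)
  ∑-𝟙 (suc m) zero    g g≈0 = begin
    1# * g 0 + ∑[ i < m ] (0# * g (suc (toℕ i)))
      ≈⟨ +-cong (*-identityˡ _) (trans (sum-cong-≋ {m} λ i → zeroˡ _) (sum-replicate-zero m)) ⟩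
    g 0 + 0#  ≈⟨ +-identityʳ _ ⟩
    g 0       ∎
  ∑-𝟙 (suc m) (suc k) g g≈0 = begin
    0# * g 0 + ∑[ i < m ] (𝟙 (k ≡ᵇ toℕ i) * g (suc (toℕ i)))
      ≈⟨ +-cong (zeroˡ _) (∑-𝟙 m k (g ∘ suc) (g≈0 ∘ s≤s)) ⟩
    0# + g (suc k)  ≈⟨ +-identityˡ _ ⟩
    g (suc k)       ∎

  ∑-𝟙-suc : ∀ m k (g : ℕ → Carrier) → (∀ {i} → m ≤ i → g i ≈ 0#) →
            ∑[ i < m ] (𝟙 (k ≡ᵇ suc (toℕ i)) * g (toℕ i)) ≈ shift g k
  ∑-𝟙-suc m zero    g g≈0 = trans (sum-cong-≋ {m} λ i → zeroˡ _) (sum-replicate-zero m)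
  ∑-𝟙-suc m (suc k) g g≈0 = ∑-𝟙 m k g g≈0

  -- The Kasteleyn weights as sums of products of one Kronecker delta per coordinate: the first
  -- bracket collects ±e₁, the second ±e₂.
  band : (k l i j : ℕ) → Carrier
  band k l i j = (𝟙 (k ≡ᵇ suc i) * 𝟙 (l ≡ᵇ j) + 𝟙 (k ≡ᵇ i) * 𝟙 (suc l ≡ᵇ j))
               + 𝕚 * (𝟙 (k ≡ᵇ i) * 𝟙 (l ≡ᵇ j) + 𝟙 (k ≡ᵇ suc i) * 𝟙 (suc l ≡ᵇ j))

  -- Reflection in the diagonal swaps the colours, sending black (k , l) to white (l , k). It fixes
  -- ±e₁ and exchanges e₂ with -e₂, so the weights survive.
  band-sym : ∀ k l i j → band k l i j ≈ band j i l k
  band-sym k l i j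
    rewrite ≡ᵇ-comm k (suc i) | ≡ᵇ-comm l j | ≡ᵇ-comm k i | ≡ᵇ-comm (suc l) j =
    solve 5 (λ I a b c d → (a :* b :+ c :* d) :+ I :* (c :* b :+ a :* d) := (d :* c :+ b :* a) :+ I :* (b :* c :+ d :* a))
      refl 𝕚 _ _ _ _

  -- A coordinate difference cannot be both 1 and -1, so at most one of the four products is nonzero
  -- and the nested conditional agrees with the sum.
  if-band : ∀ a a′ b b′ → a′ ∧ a ≡ false → b′ ∧ b ≡ false →
    (if (a′ ∧ b) ∨ (a ∧ b′) then 1# else if (a ∧ b) ∨ (a′ ∧ b′) then 𝕚 else 0#)
    ≈ (𝟙 a′ * 𝟙 b + 𝟙 a * 𝟙 b′) + 𝕚 * (𝟙 a * 𝟙 b + 𝟙 a′ * 𝟙 b′)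
  if-band false false false false _ _ = solve 1 (λ I → con 0 := (con 0 :* con 0 :+ con 0 :* con 0) :+ I :* (con 0 :* con 0 :+ con 0 :* con 0)) refl 𝕚
  if-band false false false true  _ _ = solve 1 (λ I → con 0 := (con 0 :* con 0 :+ con 0 :* con 1) :+ I :* (con 0 :* con 0 :+ con 0 :* con 1)) refl 𝕚
  if-band false false true  false _ _ = solve 1 (λ I → con 0 := (con 0 :* con 1 :+ con 0 :* con 0) :+ I :* (con 0 :* con 1 :+ con 0 :* con 0)) refl 𝕚
  if-band false true  false false _ _ = solve 1 (λ I → con 0 := (con 1 :* con 0 :+ con 0 :* con 0) :+ I :* (con 0 :* con 0 :+ con 1 :* con 0)) refl 𝕚
  if-band false true  false true  _ _ = solve 1 (λ I → I := (con 1 :* con 0 :+ con 0 :* con 1) :+ I :* (con 0 :* con 0 :+ con 1 :* con 1)) refl 𝕚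
  if-band false true  true  false _ _ = solve 1 (λ I → con 1 := (con 1 :* con 1 :+ con 0 :* con 0) :+ I :* (con 0 :* con 1 :+ con 1 :* con 0)) refl 𝕚
  if-band true  false false false _ _ = solve 1 (λ I → con 0 := (con 0 :* con 0 :+ con 1 :* con 0) :+ I :* (con 1 :* con 0 :+ con 0 :* con 0)) refl 𝕚
  if-band true  false false true  _ _ = solve 1 (λ I → con 1 := (con 0 :* con 0 :+ con 1 :* con 1) :+ I :* (con 1 :* con 0 :+ con 0 :* con 1)) refl 𝕚
  if-band true  false true  false _ _ = solve 1 (λ I → I := (con 0 :* con 1 :+ con 1 :* con 0) :+ I :* (con 1 :* con 1 :+ con 0 :* con 0)) refl 𝕚

  K-band : ∀ k l i j → K (k , l) (i , j) ≈ band (toℕ k) (toℕ l) (toℕ i) (toℕ j)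
  K-band k l i j = trans (reflexive (cong₂ (λ p q → if p then 1# else if q then 𝕚 else 0#)
      (cong₂ _∨_ (does-≟² (even-odd≡1⇔ k′ i′) (odd-even≡1⇔ l′ j′)) (does-≟² (even-odd≡-1⇔ k′ i′) (odd-even≡-1⇔ l′ j′)))
      (cong₂ _∨_ (does-≟² (even-odd≡-1⇔ k′ i′) (odd-even≡1⇔ l′ j′)) (does-≟² (even-odd≡1⇔ k′ i′) (odd-even≡-1⇔ l′ j′)))))
    (if-band (k′ ≡ᵇ i′) (k′ ≡ᵇ suc i′) (l′ ≡ᵇ j′) (suc l′ ≡ᵇ j′) (≡ᵇ-suc-exclusive k′ i′) exclusive)
    where
    k′ i′ l′ j′ : ℕ
    k′ = toℕ k ; i′ = toℕ i ; l′ = toℕ l ; j′ = toℕ j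
    exclusive : (suc l′ ≡ᵇ j′) ∧ (l′ ≡ᵇ j′) ≡ false
    exclusive rewrite ≡ᵇ-comm (suc l′) j′ | ≡ᵇ-comm l′ j′ = ≡ᵇ-suc-exclusive j′ l′

  -- The right side is the coefficient of u^k in α h_(l+1) + β h_l, where h_j is the series with
  -- coefficients `h j`. As l < n, both l and l + 1 are in the range of j; in the range of i, the
  -- vanishing hypothesis covers the neighbour that may be missing.
  ∑-band : (h : ℕ → ℕ → Carrier) → (∀ {j i} → j ≤ n → n ≤ i → h j i ≈ 0#) → ∀ k {l} → l < n →
           ∑[ i < n ] ∑[ j < suc n ] (band k l (toℕ i) (toℕ j) * h (toℕ j) (toℕ i))
           ≈ (h (suc l) k + 𝕚 * shift (h (suc l)) k) + (𝕚 * h l k + shift (h l) k)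
  ∑-band h h≈0 k {l} l<n = begin
    ∑[ i < n ] ∑[ j < suc n ] (band k l (toℕ i) (toℕ j) * h (toℕ j) (toℕ i))
      ≈⟨ sum-cong-≋ {n} (λ i → inner (toℕ i)) ⟩
    ∑[ i < n ] (𝟙 (k ≡ᵇ toℕ i) * (h (suc l) (toℕ i) + 𝕚 * h l (toℕ i))
              + 𝟙 (k ≡ᵇ suc (toℕ i)) * (h l (toℕ i) + 𝕚 * h (suc l) (toℕ i)))
      ≈⟨ ∑-distrib-+ {n} _ _ ⟩
    ∑[ i < n ] (𝟙 (k ≡ᵇ toℕ i) * (h (suc l) (toℕ i) + 𝕚 * h l (toℕ i)))
      + ∑[ i < n ] (𝟙 (k ≡ᵇ suc (toℕ i)) * (h l (toℕ i) + 𝕚 * h (suc l) (toℕ i)))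
      ≈⟨ +-cong (∑-𝟙 n k (λ i → h (suc l) i + 𝕚 * h l i) (combination≈0 l<n (ℕ.<⇒≤ l<n)))
                (∑-𝟙-suc n k (λ i → h l i + 𝕚 * h (suc l) i) (combination≈0 (ℕ.<⇒≤ l<n) l<n)) ⟩
    (h (suc l) k + 𝕚 * h l k) + shift (λ i → h l i + 𝕚 * h (suc l) i) k
      ≈⟨ rearrange k ⟩
    (h (suc l) k + 𝕚 * shift (h (suc l)) k) + (𝕚 * h l k + shift (h l) k) ∎
    where
    combination≈0 : ∀ {j j′ i} → j ≤ n → j′ ≤ n → n ≤ i → h j i + 𝕚 * h j′ i ≈ 0#
    combination≈0 j≤n j′≤n n≤i =
      trans (+-cong (h≈0 j≤n n≤i) (trans (*-congˡ (h≈0 j′≤n n≤i)) (zeroʳ _))) (+-identityˡ _)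

    inner : ∀ i → ∑[ j < suc n ] (band k l i (toℕ j) * h (toℕ j) i)
                ≈ 𝟙 (k ≡ᵇ i) * (h (suc l) i + 𝕚 * h l i) + 𝟙 (k ≡ᵇ suc i) * (h l i + 𝕚 * h (suc l) i)
    inner i = begin
      ∑[ j < suc n ] (band k l i (toℕ j) * h (toℕ j) i)
        ≈⟨ sum-cong-≋ {suc n} (λ j → solve 6 (λ I a c b d x →
             ((a :* b :+ c :* d) :+ I :* (c :* b :+ a :* d)) :* x
             := b :* ((a :+ I :* c) :* x) :+ d :* ((c :+ I :* a) :* x))
             refl 𝕚 A₁ A₀ (𝟙 (l ≡ᵇ toℕ j)) (𝟙 (suc l ≡ᵇ toℕ j)) (h (toℕ j) i)) ⟩
      ∑[ j < suc n ] (𝟙 (l ≡ᵇ toℕ j) * ((A₁ + 𝕚 * A₀) * h (toℕ j) i)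
                    + 𝟙 (suc l ≡ᵇ toℕ j) * ((A₀ + 𝕚 * A₁) * h (toℕ j) i))
        ≈⟨ ∑-distrib-+ {suc n} (λ j → 𝟙 (l ≡ᵇ toℕ j) * ((A₁ + 𝕚 * A₀) * h (toℕ j) i))
                               (λ j → 𝟙 (suc l ≡ᵇ toℕ j) * ((A₀ + 𝕚 * A₁) * h (toℕ j) i)) ⟩
      ∑[ j < suc n ] (𝟙 (l ≡ᵇ toℕ j) * ((A₁ + 𝕚 * A₀) * h (toℕ j) i))
        + ∑[ j < suc n ] (𝟙 (suc l ≡ᵇ toℕ j) * ((A₀ + 𝕚 * A₁) * h (toℕ j) i))
        ≈⟨ +-cong (∑-𝟙 (suc n) l (λ j → (A₁ + 𝕚 * A₀) * h j i) (λ n<l → contradiction l<n (ℕ.<⇒≯ n<l)))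
                  (∑-𝟙 (suc n) (suc l) (λ j → (A₀ + 𝕚 * A₁) * h j i) (λ n<1+l → contradiction l<n (ℕ.≤⇒≯ (ℕ.≤-pred n<1+l)))) ⟩
      (A₁ + 𝕚 * A₀) * h l i + (A₀ + 𝕚 * A₁) * h (suc l) i
        ≈⟨ solve 5 (λ I a c x y → (a :+ I :* c) :* x :+ (c :+ I :* a) :* y := c :* (y :+ I :* x) :+ a :* (x :+ I :* y))
             refl 𝕚 A₁ A₀ (h l i) (h (suc l) i) ⟩
      A₀ * (h (suc l) i + 𝕚 * h l i) + A₁ * (h l i + 𝕚 * h (suc l) i) ∎
      where
      A₀ A₁ : Carrier
      A₀ = 𝟙 (k ≡ᵇ i)
      A₁ = 𝟙 (k ≡ᵇ suc i)

    rearrange : ∀ k → (h (suc l) k + 𝕚 * h l k) + shift (λ i → h l i + 𝕚 * h (suc l) i) k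
                    ≈ (h (suc l) k + 𝕚 * shift (h (suc l)) k) + (𝕚 * h l k + shift (h l) k)
    rearrange zero    = solve 3 (λ I x y → (x :+ I :* y) :+ con 0 := (x :+ I :* con 0) :+ (I :* y :+ con 0)) refl 𝕚 _ _
    rearrange (suc k) = solve 5 (λ I x y a b → (x :+ I :* y) :+ (a :+ I :* b) := (x :+ I :* b) :+ (I :* y :+ a))
      refl 𝕚 _ _ _ _

  -- The monomial of this entry in G is w₁ b₂ u^i v^j s^k t^l, so for fixed j and k the entries are
  -- the coefficients of u^i t^l in `Q n j k`.
  K⁻¹ : White n → Black n → Carrier
  K⁻¹ (i , j) (k , l) = S.Q n (toℕ j) (toℕ k) (toℕ l) (toℕ i)

  private
    module E = Evaluation R commutativeRing id (Identity.isRingHomomorphism rawRing refl)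
  open E.Represents

  isInverse : IsInverse K K⁻¹
  isInverse = record
    { inverseʳ = λ { (k , l) (k′ , l′) → inverseʳ′ k l k′ l′ }
    ; inverseˡ = λ { (i , j) (i′ , j′) → inverseˡ′ i j i′ j′ }
    }
    where
    inverseʳ′ : ∀ k l k′ l′ → ∑[ i < n ] ∑[ j < suc n ] (K (k , l) (i , j) * K⁻¹ (i , j) (k′ , l′))
                            ≈ 𝟙 (does ((k , l) ≟ᵇ (k′ , l′)))
    inverseʳ′ k l k′ l′ = begin
      ∑[ i < n ] ∑[ j < suc n ] (K (k , l) (i , j) * K⁻¹ (i , j) (k′ , l′))
        ≈⟨ sum-cong-≋ {n} (λ i → sum-cong-≋ {suc n} λ j → *-congʳ {h (toℕ j) (toℕ i)} (K-band k l i j)) ⟩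
      ∑[ i < n ] ∑[ j < suc n ] (band (toℕ k) (toℕ l) (toℕ i) (toℕ j) * h (toℕ j) (toℕ i))
        -- Any point of evaluation would do, here (0 , 0): the degree bounds do not depend on it.
        ≈⟨ ∑-band h (λ j≤n n≤i → vanishesᵘ (E.represents-Q 0# 0# j≤n (Fin.toℕ≤pred[n] k′)) (toℕ l′) n≤i)
             (toℕ k) (Fin.toℕ<n l) ⟩
      _ ≈⟨ coefficient-α-β (S.Q n (suc (toℕ l)) (toℕ k′)) (S.Q n (toℕ l) (toℕ k′)) (toℕ l′) (toℕ k) ⟨
      -- The entry of the product has become the coefficient of u^k t^l′ in the monomial t^l u^k′.
      (S.α ⊗ S.Q n (suc (toℕ l)) (toℕ k′) ⊕ S.β ⊗ S.Q n (toℕ l) (toℕ k′)) (toℕ l′) (toℕ k)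
        ≈⟨ S.Q-recurrence (toℕ k′) (Fin.toℕ<n l) (toℕ l′) (toℕ k) ⟩
      (T.X ^ toℕ l ⊗ T.const U.X ^ toℕ k′) (toℕ l′) (toℕ k)
        ≈⟨ coefficient-t^u^ (toℕ l) (toℕ k′) (toℕ l′) (toℕ k) ⟩
      𝟙 (toℕ l ≡ᵇ toℕ l′) * 𝟙 (toℕ k′ ≡ᵇ toℕ k)
        ≈⟨ trans (*-comm _ _) (*-congʳ (reflexive (cong 𝟙 (≡ᵇ-comm (toℕ k′) (toℕ k))))) ⟩
      𝟙 (toℕ k ≡ᵇ toℕ k′) * 𝟙 (toℕ l ≡ᵇ toℕ l′)
        ≈⟨ 𝟙-∧ _ _ ⟨
      𝟙 ((toℕ k ≡ᵇ toℕ k′) ∧ (toℕ l ≡ᵇ toℕ l′))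
        ≡⟨ cong 𝟙 (does-≟-Fin² k k′ l l′ ((k , l) ≟ᵇ (k′ , l′))) ⟨
      𝟙 (does ((k , l) ≟ᵇ (k′ , l′))) ∎
      where
      h : ℕ → ℕ → Carrier
      h j i = S.Q n j (toℕ k′) (toℕ l′) i

    inverseˡ′ : ∀ i j i′ j′ → ∑[ k < suc n ] ∑[ l < n ] (K⁻¹ (i , j) (k , l) * K (k , l) (i′ , j′))
                            ≈ 𝟙 (does ((i , j) ≟ʷ (i′ , j′)))
    inverseˡ′ i j i′ j′ = begin
      ∑[ k < suc n ] ∑[ l < n ] (K⁻¹ (i , j) (k , l) * K (k , l) (i′ , j′))
        -- After this swap and the reflection of the weights, l takes the role of i in `∑-band` and
        -- k that of j.
        ≈⟨ ∑-comm {suc n} {n} (λ k l → K⁻¹ (i , j) (k , l) * K (k , l) (i′ , j′)) ⟩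
      ∑[ l < n ] ∑[ k < suc n ] (K⁻¹ (i , j) (k , l) * K (k , l) (i′ , j′))
        ≈⟨ sum-cong-≋ {n} (λ l → sum-cong-≋ {suc n} λ k → trans (*-comm _ _)
             (*-congʳ {h (toℕ k) (toℕ l)} (trans (K-band k l i′ j′) (band-sym (toℕ k) (toℕ l) (toℕ i′) (toℕ j′))))) ⟩
      ∑[ l < n ] ∑[ k < suc n ] (band (toℕ j′) (toℕ i′) (toℕ l) (toℕ k) * h (toℕ k) (toℕ l))
        ≈⟨ ∑-band h (λ k≤n n≤l → vanishesᵗ (E.represents-Q 0# 0# (Fin.toℕ≤pred[n] j) k≤n) (toℕ i) n≤l)
             (toℕ j′) (Fin.toℕ<n i′) ⟩
      _ ≈⟨ coefficient-γ-δ (S.Q n (toℕ j) (suc (toℕ i′))) (S.Q n (toℕ j) (toℕ i′)) (toℕ j′) (toℕ i) ⟨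
      (S.γ ⊗ S.Q n (toℕ j) (suc (toℕ i′)) ⊕ S.δ ⊗ S.Q n (toℕ j) (toℕ i′)) (toℕ j′) (toℕ i)
        ≈⟨ Quotient.Q-recurrenceʳ (powerSeries (powerSeries R)) (T.const U.X) T.X (toℕ j) (Fin.toℕ<n i′) (toℕ j′) (toℕ i) ⟩
      (T.const U.X ^ toℕ i′ ⊗ T.X ^ toℕ j) (toℕ j′) (toℕ i)
        ≈⟨ R[[u]][[t]].*-comm (T.const U.X ^ toℕ i′) (T.X ^ toℕ j) (toℕ j′) (toℕ i) ⟩
      (T.X ^ toℕ j ⊗ T.const U.X ^ toℕ i′) (toℕ j′) (toℕ i)
        ≈⟨ coefficient-t^u^ (toℕ j) (toℕ i′) (toℕ j′) (toℕ i) ⟩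
      𝟙 (toℕ j ≡ᵇ toℕ j′) * 𝟙 (toℕ i′ ≡ᵇ toℕ i)
        ≈⟨ trans (*-comm _ _) (*-congʳ (reflexive (cong 𝟙 (≡ᵇ-comm (toℕ i′) (toℕ i))))) ⟩
      𝟙 (toℕ i ≡ᵇ toℕ i′) * 𝟙 (toℕ j ≡ᵇ toℕ j′)
        ≈⟨ 𝟙-∧ _ _ ⟨
      𝟙 ((toℕ i ≡ᵇ toℕ i′) ∧ (toℕ j ≡ᵇ toℕ j′))
        ≡⟨ cong 𝟙 (does-≟-Fin² i i′ j j′ ((i , j) ≟ʷ (i′ , j′))) ⟨
      𝟙 (does ((i , j) ≟ʷ (i′ , j′))) ∎
      where
      h : ℕ → ℕ → Carrier
      h k l = S.Q n (toℕ j) k l (toℕ i)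

-- Geometric sums and telescoping

module GeometricSums {c ℓ} (A : CommutativeRing c ℓ) where
  open CommutativeRing A hiding (zero)
  open import Algebra.Properties.Semiring.Exp semiring using (_^_; ^-congˡ; ^-assocʳ; ^-congʳ)
  open import Algebra.Properties.CommutativeSemiring.Exp commutativeSemiring using (^-distrib-*)
  open import Algebra.Properties.Semiring.Sum semiring
    using (sum-syntax; sum-cong-≋; *-distribˡ-sum; *-distribʳ-sum)
  open import Relation.Binary.Reasoning.Setoid setoid
  open Solver commutativeSemiring using (solve; _:+_; _:*_; _:=_; con)

  geometric : ℕ → Carrier → Carrier
  geometric n x = ∑[ k < n ] (x ^ toℕ k)

  geometric-cong : ∀ n {x y} → x ≈ y → geometric n x ≈ geometric n y
  geometric-cong n x≈y = sum-cong-≋ {n} λ k → ^-congˡ (toℕ k) x≈y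

  geometric-suc : ∀ n x → geometric (suc n) x ≈ 1# + x * geometric n x
  geometric-suc n x = +-congˡ (sym (*-distribˡ-sum {n} x (λ k → x ^ toℕ k)))

  ∑-geometric : ∀ n x y a → ∑[ k < n ] (x ^ toℕ k * (y ^ toℕ k * a)) ≈ geometric n (x * y) * a
  ∑-geometric n x y a = trans
    (sum-cong-≋ {n} λ k → trans (sym (*-assoc _ _ _)) (*-congʳ (sym (^-distrib-* x y (toℕ k)))))
    (sym (*-distribʳ-sum {n} a (λ k → (x * y) ^ toℕ k)))

  -- Taking out the growth τ^n of the inhomogeneous term leaves a geometric sum of ratio ρ = p/τ.
  -- Starting at suc n avoids a negative power of τ.
  geometric-recurrence : ∀ {a τ ρ p} (x : ℕ → Carrier) → x 0 ≈ 0# → (∀ n → x (suc n) ≈ a * τ ^ n + p * x n) →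
                         p ≈ τ * ρ → ∀ n → x (suc n) ≈ a * τ ^ n * geometric (suc n) ρ
  geometric-recurrence {a} {τ} {ρ} {p} x x₀ step p≈τρ zero = begin
    x 1                        ≈⟨ step 0 ⟩
    a * 1# + p * x 0           ≈⟨ +-congˡ (*-congˡ x₀) ⟩
    a * 1# + p * 0#            ≈⟨ solve 2 (λ a p → a :* con 1 :+ p :* con 0 := a :* con 1 :* (con 1 :+ con 0)) refl a p ⟩
    a * 1# * (1# + 0#) ∎
  geometric-recurrence {a} {τ} {ρ} {p} x x₀ step p≈τρ (suc n) = begin
    x (suc (suc n))
      ≈⟨ step (suc n) ⟩
    a * (τ * τ ^ n) + p * x (suc n)
      ≈⟨ +-congˡ (*-cong p≈τρ (geometric-recurrence x x₀ step p≈τρ n)) ⟩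
    a * (τ * τ ^ n) + τ * ρ * (a * τ ^ n * geometric (suc n) ρ)
      ≈⟨ solve 5 (λ a τ T ρ G → a :* (τ :* T) :+ τ :* ρ :* (a :* T :* G) := a :* (τ :* T) :* (con 1 :+ ρ :* G)) refl a τ _ ρ _ ⟩
    a * (τ * τ ^ n) * (1# + ρ * geometric (suc n) ρ)
      ≈⟨ *-congˡ (geometric-suc (suc n) ρ) ⟨
    a * (τ * τ ^ n) * geometric (suc (suc n)) ρ ∎

  -- Expanding the product, v^(q+1) collects a x_(q+1) + b x_q, which is r q; only the end terms a
  -- x_0 and v^(n+1) b x_n have no partner.
  telescope : ∀ n a b v (x r : ℕ → Carrier) → (∀ {q} → q < n → a * x (suc q) + b * x q ≈ r q) →
              (a + v * b) * (∑[ q < suc n ] (v ^ toℕ q * x (toℕ q)))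
              ≈ a * x 0 + v ^ suc n * (b * x n) + v * (∑[ q < n ] (v ^ toℕ q * r (toℕ q)))
  telescope zero a b v x r rec =
    solve 4 (λ a b v x → (a :+ v :* b) :* (con 1 :* x :+ con 0) := a :* x :+ v :* con 1 :* (b :* x) :+ v :* con 0) refl a b v (x 0)
  telescope (suc n) a b v x r rec = begin
    (a + v * b) * (1# * x 0 + ∑[ q < suc n ] (v * v ^ toℕ q * x (suc (toℕ q))))
      ≈⟨ *-congˡ (+-cong (*-identityˡ _) (pull-v (suc n) (x ∘ suc))) ⟩
    (a + v * b) * (x 0 + v * (∑[ q < suc n ] (v ^ toℕ q * x (suc (toℕ q)))))
      ≈⟨ solve 5 (λ a b v x S → (a :+ v :* b) :* (x :+ v :* S) := a :* x :+ v :* (b :* x) :+ v :* ((a :+ v :* b) :* S))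
           refl a b v (x 0) _ ⟩
    a * x 0 + v * (b * x 0) + v * ((a + v * b) * (∑[ q < suc n ] (v ^ toℕ q * x (suc (toℕ q)))))
      ≈⟨ +-congˡ (*-congˡ (telescope n a b v (x ∘ suc) (r ∘ suc) (rec ∘ s≤s))) ⟩
    a * x 0 + v * (b * x 0) + v * (a * x 1 + v ^ suc n * (b * x (suc n)) + v * Σr)
      ≈⟨ solve 8 (λ a b v x₀ x₁ V y S → a :* x₀ :+ v :* (b :* x₀) :+ v :* (a :* x₁ :+ V :* y :+ v :* S)
           := a :* x₀ :+ v :* V :* y :+ v :* ((a :* x₁ :+ b :* x₀) :+ v :* S)) refl a b v (x 0) (x 1) (v ^ suc n) _ Σr ⟩
    a * x 0 + v ^ suc (suc n) * (b * x (suc n)) + v * ((a * x 1 + b * x 0) + v * Σr)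
      ≈⟨ +-congˡ (*-congˡ (+-cong (trans (rec (s≤s z≤n)) (sym (*-identityˡ _))) (sym (pull-v n (r ∘ suc))))) ⟩
    a * x 0 + v ^ suc (suc n) * (b * x (suc n)) + v * (∑[ q < suc n ] (v ^ toℕ q * r (toℕ q))) ∎
    where
    Σr : Carrier
    Σr = ∑[ q < n ] (v ^ toℕ q * r (suc (toℕ q)))
    pull-v : ∀ m (y : ℕ → Carrier) → ∑[ q < m ] (v * v ^ toℕ q * y (toℕ q)) ≈ v * (∑[ q < m ] (v ^ toℕ q * y (toℕ q)))
    pull-v m y = trans (sum-cong-≋ {m} λ q → *-assoc _ _ _) (sym (*-distribˡ-sum {m} v (λ q → v ^ toℕ q * y (toℕ q))))

  *-inverse⇒≈ : ∀ {a a⁻¹ x y} → a * a⁻¹ ≈ 1# → a * x ≈ y → x ≈ y * a⁻¹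
  *-inverse⇒≈ {a} {a⁻¹} {x} {y} inv eq = begin
    x              ≈⟨ *-identityˡ x ⟨
    1# * x         ≈⟨ *-congʳ inv ⟨
    a * a⁻¹ * x    ≈⟨ solve 3 (λ a b x → a :* b :* x := a :* x :* b) refl a a⁻¹ x ⟩
    a * x * a⁻¹    ≈⟨ *-congʳ eq ⟩
    y * a⁻¹        ∎

  ^-double : ∀ x n → x ^ (2 ℕ.* n) ≈ (x ^ 2) ^ n
  ^-double x n = sym (^-assocʳ x 2 n)

  ^-double+1 : ∀ x n → x ^ (2 ℕ.* n ℕ.+ 1) ≈ x * (x ^ 2) ^ n
  ^-double+1 x n = trans (^-congʳ x (ℕ.+-comm (2 ℕ.* n) 1)) (*-congˡ (^-double x n))

  ^-double-1 : ∀ x n → x ^ (2 ℕ.* suc n ℕ.∸ 1) ≈ x * (x ^ 2) ^ n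
  ^-double-1 x n = trans (^-congʳ x (ℕ.+-suc n (n ℕ.+ 0))) (*-congˡ (^-double x n))

  ^2-inverse : ∀ {x x⁻¹} → x * x⁻¹ ≈ 1# → x ^ 2 * x⁻¹ ^ 2 ≈ 1#
  ^2-inverse {x} {x⁻¹} inv = begin
    x ^ 2 * x⁻¹ ^ 2 ≈⟨ ^-distrib-* x x⁻¹ 2 ⟨
    (x * x⁻¹) ^ 2   ≈⟨ *-cong inv (*-congʳ inv) ⟩
    1# * (1# * 1#)  ≈⟨ trans (*-identityˡ _) (*-identityˡ _) ⟩
    1#              ∎

-- The four corner quotients as geometric sums

module CornerEntries {c ℓ} (R : CoefficientRing c ℓ) (u t : CoefficientRing.Carrier R) where
  open CoefficientRing R hiding (zero)
  open Quotient R using (𝕚*𝕚*x≈-x; 𝕚⁴*x≈x)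
  open Quotient.Bivariate R u t
  open GeometricSums commutativeRing
  open import Algebra.Properties.Semiring.Exp semiring using (_^_)
  open import Algebra.Properties.CommutativeSemiring.Exp commutativeSemiring using (^-distrib-*)
  open import Relation.Binary.Reasoning.Setoid setoid
  open Solver commutativeSemiring using (solve; _:+_; _:*_; _:=_; con)

  κ≈-𝕚½ : κ ≈ - (𝕚 * ½)
  κ≈-𝕚½ = 𝕚*𝕚*x≈-x (𝕚 * ½)

  -- Explains the extra factor i in F⁰¹ and F¹⁰: it turns the prefactor -i/2 of F into the ½ of the
  -- mixed corners, where κ does not occur.
  𝕚[-𝕚½x]≈½x : ∀ x → 𝕚 * (- (𝕚 * ½) * x) ≈ ½ * x
  𝕚[-𝕚½x]≈½x x = begin
    𝕚 * (- (𝕚 * ½) * x)                   ≈⟨ *-congˡ (*-congʳ κ≈-𝕚½) ⟨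
    𝕚 * (κ * x)                           ≈⟨ solve 3 (λ i h x → i :* (i :* (i :* (i :* h)) :* x) := (i :* (i :* (i :* (i :* (h :* x)))))) refl 𝕚 ½ x ⟩
    𝕚 * (𝕚 * (𝕚 * (𝕚 * (½ * x))))         ≈⟨ 𝕚⁴*x≈x (½ * x) ⟩
    ½ * x                                 ∎

  argument : Carrier → Carrier → Carrier
  argument w b = (1# + b * 𝕚) * (1# + w * 𝕚) * ½

  z≈argument : z ≈ argument u t
  z≈argument = solve 4 (λ i h u t → h :* ((con 1 :+ i :* u) :* (con 1 :+ i :* t)) := (con 1 :+ t :* i) :* (con 1 :+ u :* i) :* h)
    refl 𝕚 ½ u t

  -- At a corner the recursion of `Q` takes the same branch in every layer, leaving a first-order
  -- recurrence in n with constant multiplier, here z.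
  Q₀₀ : ∀ n → Q n 0 0 ≈ - (𝕚 * ½) * geometric n (argument u t)
  Q₀₀ zero    = sym (zeroʳ _)
  Q₀₀ (suc n) = begin
    κ + z * Q n 0 0
      ≈⟨ +-cong κ≈-𝕚½ (*-cong z≈argument (Q₀₀ n)) ⟩
    - (𝕚 * ½) + argument u t * (- (𝕚 * ½) * geometric n (argument u t))
      ≈⟨ solve 3 (λ k a g → k :+ a :* (k :* g) := k :* (con 1 :+ a :* g)) refl _ _ _ ⟩
    - (𝕚 * ½) * (1# + argument u t * geometric n (argument u t))
      ≈⟨ *-congˡ (geometric-suc n (argument u t)) ⟨
    - (𝕚 * ½) * geometric (suc n) (argument u t) ∎

  module _ {t⁻¹ : Carrier} (t*t⁻¹≈1 : t * t⁻¹ ≈ 1#) where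
    -- Since β = i (1 - i u) and γ = i (t - i), y = -βγ/2 equals (1 - i u)(t - i)/2; taking out t
    -- produces the arguments -u and -1/t of F.
    y≈t*argument : y ≈ t * argument (- u) (- t⁻¹)
    y≈t*argument = sym (begin
      t * ((1# + - t⁻¹ * 𝕚) * (1# + - u * 𝕚) * ½)
        ≈⟨ *-congˡ (*-congʳ (*-cong (+-congˡ (*-congʳ (𝕚*𝕚*x≈-x t⁻¹))) (+-congˡ (*-congʳ (𝕚*𝕚*x≈-x u))))) ⟨
      t * ((1# + 𝕚 * (𝕚 * t⁻¹) * 𝕚) * (1# + 𝕚 * (𝕚 * u) * 𝕚) * ½)
        ≈⟨ solve 5 (λ i h u t t′ →
             t :* ((con 1 :+ i :* (i :* t′) :* i) :* (con 1 :+ i :* (i :* u) :* i) :* h)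
             := (t :+ i :* (i :* i) :* (t :* t′)) :* (con 1 :+ i :* (i :* (i :* u))) :* h) refl 𝕚 ½ u t t⁻¹ ⟩
      (t + 𝕚 * (𝕚 * 𝕚) * (t * t⁻¹)) * (1# + 𝕚 * (𝕚 * (𝕚 * u))) * ½
        ≈⟨ *-congʳ (*-cong (+-cong (sym (𝕚⁴*x≈x t)) (*-congˡ t*t⁻¹≈1)) (+-congʳ (sym (𝕚⁴*x≈x 1#)))) ⟩
      (𝕚 * (𝕚 * (𝕚 * (𝕚 * t))) + 𝕚 * (𝕚 * 𝕚) * 1#) * (𝕚 * (𝕚 * (𝕚 * (𝕚 * 1#))) + 𝕚 * (𝕚 * (𝕚 * u))) * ½
        ≈⟨ solve 4 (λ i h u t →
             (i :* (i :* (i :* (i :* t))) :+ i :* (i :* i) :* con 1) :* (i :* (i :* (i :* (i :* con 1))) :+ i :* (i :* (i :* u))) :* h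
             := i :* (i :* (i :* (i :* (i :* (i :* (h :* ((i :+ u) :* (con 1 :+ i :* t))))))))) refl 𝕚 ½ u t ⟩
      𝕚 * (𝕚 * (𝕚 * (𝕚 * y)))
        ≈⟨ 𝕚⁴*x≈x y ⟩
      y ∎)

    Qₙ₀ : ∀ n → Q (suc n) (suc n) 0 ≈ ½ * t ^ n * geometric (suc n) (argument (- u) (- t⁻¹))
    Qₙ₀ = geometric-recurrence (λ n → Q n n 0) refl (λ n → refl) y≈t*argument

    module _ {u⁻¹ : Carrier} (u*u⁻¹≈1 : u * u⁻¹ ≈ 1#) where
      q≈tu*argument : q ≈ t * u * argument u⁻¹ t⁻¹
      q≈tu*argument = sym (begin
        t * u * ((1# + t⁻¹ * 𝕚) * (1# + u⁻¹ * 𝕚) * ½)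
          ≈⟨ solve 6 (λ i h u u′ t t′ → t :* u :* ((con 1 :+ t′ :* i) :* (con 1 :+ u′ :* i) :* h)
               := h :* ((i :* (u :* u′) :+ u) :* (i :* (t :* t′) :+ t))) refl 𝕚 ½ u u⁻¹ t t⁻¹ ⟩
        ½ * ((𝕚 * (u * u⁻¹) + u) * (𝕚 * (t * t⁻¹) + t))
          ≈⟨ *-congˡ (*-cong (+-congʳ (trans (*-congˡ u*u⁻¹≈1) (*-identityʳ 𝕚))) (+-congʳ (trans (*-congˡ t*t⁻¹≈1) (*-identityʳ 𝕚)))) ⟩
        q ∎)

      Qₙₙ : ∀ n → Q (suc n) (suc n) (suc n) ≈ - (𝕚 * ½) * (t * u) ^ n * geometric (suc n) (argument u⁻¹ t⁻¹)
      Qₙₙ n = trans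
        (geometric-recurrence (λ n → Q n n n) refl (λ n → +-congʳ (*-congˡ (sym (^-distrib-* t u n)))) q≈tu*argument n)
        (*-congʳ (*-congʳ κ≈-𝕚½))

-- The generating function

module GeneratingFunction {c ℓ c′ ℓ′} (R : CoefficientRing c ℓ) (A : CommutativeRing c′ ℓ′)
                          (φ : CoefficientRing.Carrier R → CommutativeRing.Carrier A)
                          (φ-hom : IsRingHomomorphism (CoefficientRing.rawRing R) (CommutativeRing.rawRing A) φ)
                          (m : ℕ) (w₁ w₂ b₁ b₂ : CommutativeRing.Carrier A) where
  private
    module E = Evaluation R A φ φ-hom
    n : ℕ
    n = suc m
  open CommutativeRing A hiding (zero)
  open CoefficientRing E.extension using (𝕚; ½)
  open GeometricSums A
  open Series R A φ
  open Inverse R n using (K⁻¹)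
  open import Algebra.Properties.Semiring.Exp semiring using (_^_)
  open import Algebra.Properties.CommutativeSemiring.Exp commutativeSemiring using (^-distrib-*)
  open import Algebra.Properties.Semiring.Sum semiring
    using (sum-syntax; sum-cong-≋; ∑-comm; ∑-distrib-+; *-distribˡ-sum)
  open import Relation.Binary.Reasoning.Setoid setoid
  open Solver commutativeSemiring using (solve; _:+_; _:*_; _:=_; con)

  u v s t : Carrier
  u = w₁ ^ 2
  v = w₂ ^ 2
  s = b₁ ^ 2
  t = b₂ ^ 2

  open Quotient.Bivariate E.extension u t
  open Quotient E.extension using (Q-sym; Q-recurrenceʳ)

  row : ℕ → Carrier
  row j = ∑[ k < suc n ] (s ^ toℕ k * Q n j (toℕ k))

  -- The summations are reordered so that the exponents of u and t run innermost; that inner sum is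
  -- the evaluation of `Q n q r` in A.
  G≈∑row : G n K⁻¹ w₁ w₂ b₁ b₂ ≈ w₁ * b₂ * (∑[ j < suc n ] (v ^ toℕ j * row (toℕ j)))
  G≈∑row = begin
    ∑[ p < n ] ∑[ q < suc n ] ∑[ r < suc n ] ∑[ s < n ] term p q r s
      ≈⟨ ∑-comm {n} {suc n} (λ p q → ∑[ r < suc n ] ∑[ s < n ] term p q r s) ⟩
    ∑[ q < suc n ] ∑[ p < n ] ∑[ r < suc n ] ∑[ s < n ] term p q r s
      ≈⟨ sum-cong-≋ {suc n} (λ q → ∑-comm {n} {suc n} (λ p r → ∑[ s < n ] term p q r s)) ⟩
    ∑[ q < suc n ] ∑[ r < suc n ] ∑[ p < n ] ∑[ s < n ] term p q r s
      ≈⟨ sum-cong-≋ {suc n} (λ q → sum-cong-≋ {suc n} (λ r → entry q r)) ⟩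
    ∑[ q < suc n ] ∑[ r < suc n ] (w₁ * b₂ * v ^ toℕ q * (s ^ toℕ r * Q n (toℕ q) (toℕ r)))
      ≈⟨ sum-cong-≋ {suc n} (λ q → trans
           (sym (*-distribˡ-sum {suc n} (w₁ * b₂ * v ^ toℕ q) (λ r → s ^ toℕ r * Q n (toℕ q) (toℕ r))))
           (*-assoc _ _ _)) ⟩
    ∑[ q < suc n ] (w₁ * b₂ * (v ^ toℕ q * row (toℕ q)))
      ≈⟨ *-distribˡ-sum {suc n} (w₁ * b₂) (λ q → v ^ toℕ q * row (toℕ q)) ⟨
    w₁ * b₂ * (∑[ q < suc n ] (v ^ toℕ q * row (toℕ q))) ∎
    where
    term : Fin n → Fin (suc n) → Fin (suc n) → Fin n → Carrier
    term p q r s = φ (K⁻¹ (p , q) (r , s))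
      * w₁ ^ (2 ℕ.* toℕ p ℕ.+ 1) * w₂ ^ (2 ℕ.* toℕ q)
      * b₁ ^ (2 ℕ.* toℕ r) * b₂ ^ (2 ℕ.* toℕ s ℕ.+ 1)

    factor : ∀ p q r s′ → term p q r s′
      ≈ w₁ * b₂ * v ^ toℕ q * s ^ toℕ r * (φ (K⁻¹ (p , q) (r , s′)) * E.monomial u t (toℕ p) (toℕ s′))
    factor p q r s′ = trans
      (*-cong (*-cong (*-cong (*-congˡ (^-double+1 w₁ (toℕ p))) (^-double w₂ (toℕ q))) (^-double b₁ (toℕ r)))
              (^-double+1 b₂ (toℕ s′)))
      (solve 7 (λ x w b U V S T → x :* (w :* U) :* V :* S :* (b :* T) := w :* b :* V :* S :* (x :* (U :* T)))
        refl _ w₁ b₂ _ _ _ _)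

    entry : ∀ q r → ∑[ p < n ] ∑[ s < n ] term p q r s
                  ≈ w₁ * b₂ * v ^ toℕ q * (s ^ toℕ r * Q n (toℕ q) (toℕ r))
    entry q r = begin
      ∑[ p < n ] ∑[ s < n ] term p q r s
        ≈⟨ sum-cong-≋ {n} (λ p → sum-cong-≋ {n} (factor p q r)) ⟩
      ∑[ p < n ] ∑[ s′ < n ] (w₁ * b₂ * v ^ toℕ q * s ^ toℕ r
                              * (φ (K⁻¹ (p , q) (r , s′)) * E.monomial u t (toℕ p) (toℕ s′)))
        ≈⟨ E.∑∑-scale u t n n (w₁ * b₂ * v ^ toℕ q * s ^ toℕ r)
             (λ p s′ → φ (K⁻¹ (p , q) (r , s′)) * E.monomial u t (toℕ p) (toℕ s′)) ⟩
      w₁ * b₂ * v ^ toℕ q * s ^ toℕ r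
        * (∑[ p < n ] ∑[ s′ < n ] (φ (K⁻¹ (p , q) (r , s′)) * E.monomial u t (toℕ p) (toℕ s′)))
        ≈⟨ *-congˡ (E.Represents.evaluates (E.represents-Q u t (Fin.toℕ≤pred[n] q) (Fin.toℕ≤pred[n] r))) ⟩
      w₁ * b₂ * v ^ toℕ q * s ^ toℕ r * Q n (toℕ q) (toℕ r)
        ≈⟨ *-assoc _ _ _ ⟩
      w₁ * b₂ * v ^ toℕ q * (s ^ toℕ r * Q n (toℕ q) (toℕ r)) ∎

  -- The recurrence in j holds for all n + 1 values of k, so summing over k produces f with index n
  -- + 1.
  row-recurrence : ∀ {j} → j < n → α * row (suc j) + β * row j ≈ t ^ j * f (suc n) (u * s)
  row-recurrence {j} j<n = begin
    α * row (suc j) + β * row j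
      ≈⟨ +-cong (*-distribˡ-sum {suc n} α (λ k → s ^ toℕ k * Q n (suc j) (toℕ k)))
                (*-distribˡ-sum {suc n} β (λ k → s ^ toℕ k * Q n j (toℕ k))) ⟩
    ∑[ k < suc n ] (α * (s ^ toℕ k * Q n (suc j) (toℕ k))) + ∑[ k < suc n ] (β * (s ^ toℕ k * Q n j (toℕ k)))
      ≈⟨ ∑-distrib-+ {suc n} (λ k → α * (s ^ toℕ k * Q n (suc j) (toℕ k))) (λ k → β * (s ^ toℕ k * Q n j (toℕ k))) ⟨
    ∑[ k < suc n ] (α * (s ^ toℕ k * Q n (suc j) (toℕ k)) + β * (s ^ toℕ k * Q n j (toℕ k)))
      ≈⟨ sum-cong-≋ {suc n} (λ k → trans
           (solve 5 (λ a b S x y → a :* (S :* x) :+ b :* (S :* y) := S :* (a :* x :+ b :* y)) refl α β (s ^ toℕ k) _ _)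
           (*-congˡ (trans (Q-recurrence (toℕ k) j<n) (*-comm _ _)))) ⟩
    ∑[ k < suc n ] (s ^ toℕ k * (u ^ toℕ k * t ^ j))
      ≈⟨ ∑-geometric (suc n) s u (t ^ j) ⟩
    f (suc n) (s * u) * t ^ j
      ≈⟨ trans (*-comm _ _) (*-congˡ (geometric-cong (suc n) (*-comm s u))) ⟩
    t ^ j * f (suc n) (u * s) ∎

  α+vβ≈C : α + v * β ≈ C w₁ w₂
  α+vβ≈C = solve 3 (λ i u v → (con 1 :+ i :* u) :+ v :* (i :+ u) := con 1 :+ u :* v :+ i :* (u :+ v)) refl 𝕚 u v

  γ+sδ≈C : γ + s * δ ≈ C b₁ b₂
  γ+sδ≈C = solve 3 (λ i s t → (con 1 :+ i :* t) :+ s :* (i :+ t) := con 1 :+ s :* t :+ i :* (s :+ t)) refl 𝕚 s t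

  -- Only the rows 0 and n survive; their weights α and β become the prefactors 1 + i w₁² and i +
  -- w₁² of the formula.
  C*∑row : C w₁ w₂ * (∑[ j < suc n ] (v ^ toℕ j * row (toℕ j)))
           ≈ α * row 0 + v ^ suc n * (β * row n) + v * (f n (v * t) * f (suc n) (u * s))
  C*∑row = begin
    C w₁ w₂ * (∑[ j < suc n ] (v ^ toℕ j * row (toℕ j)))
      ≈⟨ *-congʳ α+vβ≈C ⟨
    (α + v * β) * (∑[ j < suc n ] (v ^ toℕ j * row (toℕ j)))
      ≈⟨ telescope n α β v row (λ j → t ^ j * f (suc n) (u * s)) row-recurrence ⟩
    α * row 0 + v ^ suc n * (β * row n) + v * (∑[ j < n ] (v ^ toℕ j * (t ^ toℕ j * f (suc n) (u * s))))
      ≈⟨ +-congˡ (*-congˡ (∑-geometric n v t (f (suc n) (u * s)))) ⟩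
    α * row 0 + v ^ suc n * (β * row n) + v * (f n (v * t) * f (suc n) (u * s)) ∎

  -- Here the telescoped recurrence is available only for k < n, hence f with index n.
  C*row : ∀ j → C b₁ b₂ * row j ≈ γ * Q n j 0 + s ^ suc n * (δ * Q n j n) + s * (f n (s * u) * t ^ j)
  C*row j = begin
    C b₁ b₂ * row j
      ≈⟨ *-congʳ γ+sδ≈C ⟨
    (γ + s * δ) * row j
      ≈⟨ telescope n γ δ s (Q n j) (λ k → u ^ k * t ^ j) (Q-recurrenceʳ u t j) ⟩
    γ * Q n j 0 + s ^ suc n * (δ * Q n j n) + s * (∑[ k < n ] (s ^ toℕ k * (u ^ toℕ k * t ^ j)))
      ≈⟨ +-congˡ (*-congˡ (∑-geometric n s u (t ^ j))) ⟩
    γ * Q n j 0 + s ^ suc n * (δ * Q n j n) + s * (f n (s * u) * t ^ j) ∎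

  module _ (w₁⁻¹ b₂⁻¹ Cw⁻¹ Cb⁻¹ : Carrier) (w₁-inv : w₁ * w₁⁻¹ ≈ 1#) (b₂-inv : b₂ * b₂⁻¹ ≈ 1#) where
    open Corners n w₁ w₂ b₁ b₂ w₁⁻¹ b₂⁻¹
    private
      module Corner = CornerEntries E.extension u t
      module Cornerᵀ = CornerEntries E.extension t u
      u-inv : u * w₁⁻¹ ^ 2 ≈ 1#
      u-inv = ^2-inverse w₁-inv
      t-inv : t * b₂⁻¹ ^ 2 ≈ 1#
      t-inv = ^2-inverse b₂-inv

    F⁰⁰≈ : F⁰⁰ ≈ w₁ * b₂ * Q n 0 0
    F⁰⁰≈ = trans (*-congʳ (*-congʳ (sym (Corner.Q₀₀ n)))) (trans (*-assoc _ _ _) (*-comm _ _))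

    F¹⁰≈ : F¹⁰ ≈ w₁ * b₂ * (v ^ n * Q n n 0)
    F¹⁰≈ = begin
      F n (- u) (- (b₂⁻¹ ^ 2)) * w₁ * w₂ ^ (2 ℕ.* n) * b₂ ^ (2 ℕ.* n ℕ.∸ 1) * 𝕚
        ≈⟨ *-congʳ (*-cong (*-congˡ (^-double w₂ n)) (^-double-1 b₂ m)) ⟩
      - (𝕚 * ½) * g * w₁ * v ^ n * (b₂ * t ^ m) * 𝕚
        ≈⟨ solve 7 (λ k g w V b T i → k :* g :* w :* V :* (b :* T) :* i := w :* b :* (V :* (i :* (k :* (T :* g))))) refl _ g w₁ _ b₂ _ 𝕚 ⟩
      w₁ * b₂ * (v ^ n * (𝕚 * (- (𝕚 * ½) * (t ^ m * g))))
        ≈⟨ *-congˡ (*-congˡ (trans (Corner.𝕚[-𝕚½x]≈½x _) (sym (*-assoc _ _ _)))) ⟩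
      w₁ * b₂ * (v ^ n * (½ * t ^ m * g))
        ≈⟨ *-congˡ (*-congˡ (Corner.Qₙ₀ t-inv m)) ⟨
      w₁ * b₂ * (v ^ n * Q n n 0) ∎
      where
      g : Carrier
      g = geometric n (Corner.argument (- u) (- (b₂⁻¹ ^ 2)))

    F⁰¹≈ : F⁰¹ ≈ w₁ * b₂ * (s ^ n * Q n 0 n)
    F⁰¹≈ = begin
      F n (- (w₁⁻¹ ^ 2)) (- t) * w₁ ^ (2 ℕ.* n ℕ.∸ 1) * b₁ ^ (2 ℕ.* n) * b₂ * 𝕚
        -- This corner is reached through the transposed quotient, so the two factors in the
        -- argument of F appear in the opposite order.
        ≈⟨ *-congʳ (*-congʳ (*-cong (*-cong (*-congˡ (geometric-cong n (*-congʳ (*-comm _ _)))) (^-double-1 w₁ m)) (^-double b₁ n))) ⟩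
      - (𝕚 * ½) * g * (w₁ * u ^ m) * s ^ n * b₂ * 𝕚
        ≈⟨ solve 7 (λ k g w U S b i → k :* g :* (w :* U) :* S :* b :* i := w :* b :* (S :* (i :* (k :* (U :* g))))) refl _ g w₁ _ _ b₂ 𝕚 ⟩
      w₁ * b₂ * (s ^ n * (𝕚 * (- (𝕚 * ½) * (u ^ m * g))))
        ≈⟨ *-congˡ (*-congˡ (trans (Corner.𝕚[-𝕚½x]≈½x _) (sym (*-assoc _ _ _)))) ⟩
      w₁ * b₂ * (s ^ n * (½ * u ^ m * g))
        ≈⟨ *-congˡ (*-congˡ (trans (Q-sym u t n 0 n) (Cornerᵀ.Qₙ₀ u-inv m))) ⟨
      w₁ * b₂ * (s ^ n * Q n 0 n) ∎
      where
      g : Carrier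
      g = geometric n (Corner.argument (- t) (- (w₁⁻¹ ^ 2)))

    F¹¹≈ : F¹¹ ≈ w₁ * b₂ * (v ^ n * (s ^ n * Q n n n))
    F¹¹≈ = begin
      F n (w₁⁻¹ ^ 2) (b₂⁻¹ ^ 2) * w₁ ^ (2 ℕ.* n ℕ.∸ 1) * w₂ ^ (2 ℕ.* n) * b₁ ^ (2 ℕ.* n) * b₂ ^ (2 ℕ.* n ℕ.∸ 1)
        ≈⟨ *-cong (*-cong (*-cong (*-congˡ (^-double-1 w₁ m)) (^-double w₂ n)) (^-double b₁ n)) (^-double-1 b₂ m) ⟩
      - (𝕚 * ½) * g * (w₁ * u ^ m) * v ^ n * s ^ n * (b₂ * t ^ m)
        ≈⟨ solve 8 (λ k g w U V S b T → k :* g :* (w :* U) :* V :* S :* (b :* T) := w :* b :* (V :* (S :* (k :* (T :* U) :* g))))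
             refl _ g w₁ _ _ _ b₂ _ ⟩
      w₁ * b₂ * (v ^ n * (s ^ n * (- (𝕚 * ½) * (t ^ m * u ^ m) * g)))
        ≈⟨ *-congˡ (*-congˡ (*-congˡ (trans (Corner.Qₙₙ t-inv u-inv m) (*-congʳ (*-congˡ (^-distrib-* t u m)))))) ⟨
      w₁ * b₂ * (v ^ n * (s ^ n * Q n n n)) ∎
      where
      g : Carrier
      g = geometric n (Corner.argument (w₁⁻¹ ^ 2) (b₂⁻¹ ^ 2))

    G-formula : C w₁ w₂ * Cw⁻¹ ≈ 1# → C b₁ b₂ * Cb⁻¹ ≈ 1# →
      G n K⁻¹ w₁ w₂ b₁ b₂
        ≈ (w₁ * v * b₂ * f (suc n) (u * s) * f n (v * t)) * Cw⁻¹
        + (1# + i * u)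
            * ((1# + i * t) * F⁰⁰ + s * (b₂ * w₁ * f n (s * u) + (i + t) * F⁰¹))
            * (Cw⁻¹ * Cb⁻¹)
        + (i + u) * v
            * (s * b₂ ^ (2 ℕ.* n ℕ.+ 1) * w₁ * w₂ ^ (2 ℕ.* n) * f n (s * u)
               + (1# + i * t) * F¹⁰
               + s * (i + t) * F¹¹)
            * (Cw⁻¹ * Cb⁻¹)
    G-formula Cw-inv Cb-inv = begin
      G n K⁻¹ w₁ w₂ b₁ b₂
        ≈⟨ G≈∑row ⟩
      w₁ * b₂ * (∑[ j < suc n ] (v ^ toℕ j * row (toℕ j)))
        ≈⟨ *-congˡ (*-inverse⇒≈ Cw-inv C*∑row) ⟩
      w₁ * b₂ * ((α * row 0 + v ^ suc n * (β * row n) + v * (f n (v * t) * f (suc n) (u * s))) * Cw⁻¹)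
        ≈⟨ *-congˡ (*-congʳ (+-congʳ (+-cong (*-congˡ (*-inverse⇒≈ Cb-inv (C*row 0)))
                                             (*-congˡ (*-congˡ (*-inverse⇒≈ Cb-inv (C*row n))))))) ⟩
      w₁ * b₂ * ((α * ((γ * Q n 0 0 + s ^ suc n * (δ * Q n 0 n) + s * (f n (s * u) * 1#)) * Cb⁻¹)
                + v ^ suc n * (β * ((γ * Q n n 0 + s ^ suc n * (δ * Q n n n) + s * (f n (s * u) * t ^ n)) * Cb⁻¹))
                + v * (f n (v * t) * f (suc n) (u * s))) * Cw⁻¹)
        -- With powers, corners and sums as atoms, v^(n+1) and s^(n+1) are split and the prefactor
        -- w₁ b₂ is moved onto each corner. T = t^n comes from row n and gives b₂^(2n+1); in row 0
        -- its place is taken by 1.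
        ≈⟨ solve 20 (λ α β γ δ w b v V s S T q₀₀ q₀ₙ qₙ₀ qₙₙ fsu fvt fus cw cb →
             w :* b :* ((α :* ((γ :* q₀₀ :+ s :* S :* (δ :* q₀ₙ) :+ s :* (fsu :* con 1)) :* cb)
               :+ v :* V :* (β :* ((γ :* qₙ₀ :+ s :* S :* (δ :* qₙₙ) :+ s :* (fsu :* T)) :* cb))
               :+ v :* (fvt :* fus)) :* cw)
             := (w :* v :* b :* fus :* fvt) :* cw
               :+ α :* (γ :* (w :* b :* q₀₀) :+ s :* (b :* w :* fsu :+ δ :* (w :* b :* (S :* q₀ₙ)))) :* (cw :* cb)
               :+ β :* v :* (s :* (b :* T) :* w :* V :* fsu :+ γ :* (w :* b :* (V :* qₙ₀))
                    :+ s :* δ :* (w :* b :* (V :* (S :* qₙₙ)))) :* (cw :* cb))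
             refl α β γ δ w₁ b₂ v (v ^ n) s (s ^ n) (t ^ n) (Q n 0 0) (Q n 0 n) (Q n n 0) (Q n n n)
               (f n (s * u)) (f n (v * t)) (f (suc n) (u * s)) Cw⁻¹ Cb⁻¹ ⟩
      (w₁ * v * b₂ * f (suc n) (u * s) * f n (v * t)) * Cw⁻¹
        + α * (γ * (w₁ * b₂ * Q n 0 0) + s * (b₂ * w₁ * f n (s * u) + δ * (w₁ * b₂ * (s ^ n * Q n 0 n)))) * (Cw⁻¹ * Cb⁻¹)
        + β * v * (s * (b₂ * t ^ n) * w₁ * v ^ n * f n (s * u) + γ * (w₁ * b₂ * (v ^ n * Q n n 0))
                   + s * δ * (w₁ * b₂ * (v ^ n * (s ^ n * Q n n n)))) * (Cw⁻¹ * Cb⁻¹)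
        ≈⟨ +-cong
             (+-congˡ (*-congʳ (*-congˡ (+-cong (*-congˡ F⁰⁰≈) (*-congˡ (+-congˡ (*-congˡ F⁰¹≈)))))))
             (*-congʳ (*-congˡ (+-cong
               (+-cong (*-congʳ (*-cong (*-congʳ (*-congˡ (^-double+1 b₂ n))) (^-double w₂ n))) (*-congˡ F¹⁰≈))
               (*-congˡ F¹¹≈)))) ⟨
      _ ∎

theorem1 :
  ∀ {c ℓ c′ ℓ′} (R : CoefficientRing c ℓ) (n : ℕ) → n ≥ 1 →
  let module R = CoefficientRing R
      open Kasteleyn R n
  in
  Σ (White n → Black n → R.Carrier) λ K⁻¹ →
  IsInverse K K⁻¹ ×
  ((A : CommutativeRing c′ ℓ′) →
   let open CommutativeRing A
       open Algebra.Properties.Semiring.Exp semiring using (_^_)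
   in
   (φ : R.Carrier → Carrier) →
   IsRingHomomorphism R.rawRing rawRing φ →
   let open Series R A φ in
   (w₁ w₂ b₁ b₂ w₁⁻¹ b₂⁻¹ Cw⁻¹ Cb⁻¹ : Carrier) →
   w₁ * w₁⁻¹ ≈ 1# →
   b₂ * b₂⁻¹ ≈ 1# →
   C w₁ w₂ * Cw⁻¹ ≈ 1# →
   C b₁ b₂ * Cb⁻¹ ≈ 1# →
   let open Corners n w₁ w₂ b₁ b₂ w₁⁻¹ b₂⁻¹ in
   G n K⁻¹ w₁ w₂ b₁ b₂
     ≈ (w₁ * w₂ ^ 2 * b₂ * f (suc n) (w₁ ^ 2 * b₁ ^ 2) * f n (w₂ ^ 2 * b₂ ^ 2)) * Cw⁻¹
     + (1# + i * w₁ ^ 2)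
         * ((1# + i * b₂ ^ 2) * F⁰⁰
            + b₁ ^ 2 * (b₂ * w₁ * f n (b₁ ^ 2 * w₁ ^ 2) + (i + b₂ ^ 2) * F⁰¹))
         * (Cw⁻¹ * Cb⁻¹)
     + (i + w₁ ^ 2) * w₂ ^ 2
         * (b₁ ^ 2 * b₂ ^ (2 ℕ.* n ℕ.+ 1) * w₁ * w₂ ^ (2 ℕ.* n) * f n (b₁ ^ 2 * w₁ ^ 2)
            + (1# + i * b₂ ^ 2) * F¹⁰
            + b₁ ^ 2 * (i + b₂ ^ 2) * F¹¹)
         * (Cw⁻¹ * Cb⁻¹))
theorem1 R (suc m) _ = Inverse.K⁻¹ R (suc m) , Inverse.isInverse R (suc m) ,
  λ A φ φ-hom w₁ w₂ b₁ b₂ w₁⁻¹ b₂⁻¹ Cw⁻¹ Cb⁻¹ w₁-inv b₂-inv →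
    GeneratingFunction.G-formula R A φ φ-hom m w₁ w₂ b₁ b₂ w₁⁻¹ b₂⁻¹ Cw⁻¹ Cb⁻¹ w₁-inv b₂-inv
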